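{- Consider any sequence of existing finite generalized quadrangles, or any sequence of existing finite generalized hexagons, of equal order $(s,s)$ with $s\to\infty$, and let $B_s$ denote the incidence graph of the member of order $(s,s)$. Then the line graphs $L(B_s)$ satisfy $$h_r^{\mathrm f}(L(B_s))\to\infty$$ for every fixed integer $r\ge 4$ not exceeding the girth of the incidence graph (which is $8$ for quadrangles and $12$ for hexagons). More quantitatively, if $\Delta_s=s+1$, then for every $0<\theta<1/(r-1)$ there is a constant $c=c(r,\theta)>0$ such that $$h_r^{\mathrm f}(L(B_s))\ge c\,\frac{\Delta_s^\theta}{\log\Delta_s}$$ for all sufficiently large $s$ in the sequence.
   Context: All graphs are finite and simple; subgraphs need not be induced. $\chi_{\mathrm f}$ is the fractional chromatic number; $\log$ is natural. The girth of a forest is $\infty$. $h_r^{\mathrm f}(G)=\max\{\chi_{\mathrm f}(H):H\subseteq G,\ \operatorname{girth}(H)\ge r\}$. A generalized quadrangle (resp. hexagon) is a point-line incidence geometry whose bipartite point-line incidence graph has diameter $4$ and girth $8$ (resp. diameter $6$ and girth $12$); it has order $(s,s)$ if every line contains exactly $s+1$ points and every point lies on exactly $s+1$ lines. $L(B)$ is the line graph of $B$. -}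

module Defs where

open import Algebra.Definitions.RawSemiring using () renaming (_^_ to pow)
open import Data.Bool.Base using (Bool; true; false; T; if_then_else_)
open import Data.Bool.Properties using (T?)
open import Data.Fin.Base using (Fin; zero; suc; inject₁; fromℕ; splitAt)
import Data.Fin.Base as Fin
open import Data.Fin.Properties using (any?) renaming (_≟_ to _≟ᶠ_; _<?_ to _<?ᶠ_)
open import Data.Fin.Subset using (Subset; _∈_; ∣_∣; inside; outside)
open import Data.Fin.Subset.Properties using (_∈?_)
open import Data.Integer.Base using (+_)
open import Data.List.Base using (List; allFin; cartesianProduct; filter; length; lookup)
open import Data.Nat.Base as ℕ using (ℕ; zero; suc; _!)
open import Data.Nat.Properties using (_!≢0)
open import Data.Product.Base using (Σ; ∃; _×_; _,_; proj₁)
open import Data.Rational.Base using (ℚ; 0ℚ; 1ℚ; _+_; _*_; _/_; _<_; _≤_; +-*-rawSemiring)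
open import Data.Sum.Base using (_⊎_; inj₁; inj₂)
open import Data.Vec.Base using ([]; _∷_; tabulate)
open import Function.Base using (_∘_)
open import Function.Definitions using (Injective)
open import Relation.Binary.PropositionalEquality using (_≡_; _≢_; refl; sym)
open import Relation.Nullary using (¬_; Dec; does)
open import Relation.Nullary.Decidable
  using (⌊_⌋; toWitness; fromWitness; _×-dec_; _⊎-dec_; ¬?)

------------------------------------------------------------------------
-- Real numbers

-- lower q is read "q < x" and upper q is read "x < q".
record Cut : Set₁ where
  field
    lower : ℚ → Set
    upper : ℚ → Set

open Cut public

record IsDedekind (x : Cut) : Set where
  field
    lower-inhabited : ∃ λ q → lower x q
    upper-inhabited : ∃ λ q → upper x q
    lower-closed    : ∀ {p q} → p < q → lower x q → lower x p
    upper-closed    : ∀ {p q} → p < q → upper x p → upper x q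
    lower-open      : ∀ {p} → lower x p → ∃ λ q → p < q × lower x q
    upper-open      : ∀ {q} → upper x q → ∃ λ p → p < q × upper x p
    disjoint        : ∀ {q} → lower x q → ¬ upper x q
    located         : ∀ {p q} → p < q → lower x p ⊎ upper x q

record ℝ : Set₁ where
  field
    cut        : Cut
    isDedekind : IsDedekind cut

open ℝ public

infix 4 _<ᶜ_ _≤ᶜ_

_<ᶜ_ : Cut → Cut → Set
x <ᶜ y = ∃ λ q → upper x q × lower y q

_≤ᶜ_ : Cut → Cut → Set
x ≤ᶜ y = ∀ q → lower x q → lower y q

fromℚ : ℚ → Cut
fromℚ p .lower q = q < p
fromℚ p .upper q = p < q

natℚ : ℕ → ℚ
natℚ n = + n / 1

fromℕᶜ : ℕ → Cut
fromℕᶜ n = fromℚ (natℚ n)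

infixl 7 _⊗_ _⊘_

-- Product of two positive reals.
_⊗_ : Cut → Cut → Cut
(x ⊗ y) .lower q = ∃ λ a → ∃ λ b →
  lower x a × lower y b × 0ℚ ≤ a × 0ℚ ≤ b × q < a * b
(x ⊗ y) .upper q = ∃ λ a → ∃ λ b → upper x a × upper y b × a * b < q

-- Quotient of a nonnegative real by a positive real.
_⊘_ : Cut → Cut → Cut
(x ⊘ y) .lower q = ∃ λ a → ∃ λ b → lower x a × upper y b × q * b < a
(x ⊘ y) .upper q = ∃ λ a → ∃ λ b → upper x a × lower y b × 0ℚ < b × a < q * b

infixr 8 _^_

_^_ : ℚ → ℕ → ℚ
_^_ = pow +-*-rawSemiring

-- n ^ᶜ θ is the real power of an integer n ≥ 1 with exponent θ > 0, squeezed
-- between the rational powers n ^ (a / (b+1)); q < n ^ (a / (b+1)) is written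
-- q ^ (b+1) < n ^ a, which is the same for q ≥ 0.
infixr 8 _^ᶜ_

_^ᶜ_ : ℕ → Cut → Cut
(n ^ᶜ θ) .lower q = q < 0ℚ ⊎
  (∃ λ a → ∃ λ b → lower θ (+ a / suc b) × q ^ suc b < natℚ n ^ a)
(n ^ᶜ θ) .upper q = 0ℚ < q ×
  (∃ λ a → ∃ λ b → upper θ (+ a / suc b) × natℚ n ^ a < q ^ suc b)

expSum : ℕ → ℚ → ℚ
expSum zero    q = 0ℚ
expSum (suc k) q = expSum k q + q ^ k * _/_ (+ 1) (k !) {{k !≢0}}

-- The exponential of a rational q ≥ 0: the partial sums increase to it.
exp : ℚ → Cut
exp q .lower p = ∃ λ k → p < expSum k q
exp q .upper p = ∃ λ p′ → p′ < p × (∀ k → expSum k q ≤ p′)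

-- The natural logarithm of an integer n ≥ 1, as the inverse of exp.
log : ℕ → Cut
log n .lower q = q < 0ℚ ⊎ upper (exp q) (natℚ n)
log n .upper q = 0ℚ ≤ q × lower (exp q) (natℚ n)

inf : {I : Set} → (I → ℚ) → Cut
inf f .lower q = ∃ λ q′ → q < q′ × (∀ i → q′ ≤ f i)
inf f .upper q = ∃ λ i → f i < q

-- The maximum of a family of reals taking finitely many values: q is below the
-- maximum iff it is below some member, above it iff it is above every member.
max : {I : Set} → (I → Cut) → Cut
max x .lower q = ∃ λ i → lower (x i) q
max x .upper q = ∀ i → upper (x i) q

-- recip n is 1 / n, with the convention recip 0 = 0.
recip : ℕ → ℚ
recip zero    = 0ℚ
recip (suc n) = + 1 / suc n

------------------------------------------------------------------------
-- Graphs

record Graph : Set where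
  field
    order  : ℕ
    adj    : Fin order → Fin order → Bool

  Vertex : Set
  Vertex = Fin order

  Adj : Vertex → Vertex → Set
  Adj u v = T (adj u v)

  field
    adj-sym    : ∀ {u v} → Adj u v → Adj v u
    adj-irrefl : ∀ {u} → ¬ Adj u u

open Graph public

-- H is, up to isomorphism, a (not necessarily induced or spanning) subgraph
-- of G; girth and fractional chromatic number are isomorphism invariant.
infix 4 _⊆ᴳ_

record _⊆ᴳ_ (H G : Graph) : Set where
  field
    embed     : Vertex H → Vertex G
    injective : Injective _≡_ _≡_ embed
    preserves : ∀ {u v} → Adj H u v → Adj G (embed u) (embed v)

module _ (G : Graph) where

  data Walk : Vertex G → Vertex G → ℕ → Set where
    here : ∀ {u} → Walk u u 0
    step : ∀ {u v w k} → Adj G u v → Walk v w k → Walk u w (suc k)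

  Distance≤ : Vertex G → Vertex G → ℕ → Set
  Distance≤ u v d = ∃ λ k → k ℕ.≤ d × Walk u v k

  Distance≥ : Vertex G → Vertex G → ℕ → Set
  Distance≥ u v d = ∀ {k} → Walk u v k → d ℕ.≤ k

  HasDiameter : ℕ → Set
  HasDiameter d = (∀ u v → Distance≤ u v d) × (∃ λ u → ∃ λ v → Distance≥ u v d)

  -- A cycle with 1 + m vertices.
  record CycleOn (m : ℕ) : Set where
    field
      3≤length : 3 ℕ.≤ suc m
      vertex   : Fin (suc m) → Vertex G
      distinct : Injective _≡_ _≡_ vertex
      edge     : ∀ (i : Fin m) → Adj G (vertex (inject₁ i)) (vertex (suc i))
      closing  : Adj G (vertex (fromℕ m)) (vertex zero)

  -- Holds for every g when G is a forest.
  Girth≥ : ℕ → Set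
  Girth≥ g = ∀ {m} → CycleOn m → g ℕ.≤ suc m

  HasGirth : ℕ → Set
  HasGirth g = Girth≥ g × (∃ λ m → suc m ≡ g × CycleOn m)

  Independent : Subset (order G) → Set
  Independent S = ∀ {u v} → u ∈ S → v ∈ S → ¬ Adj G u v

  edges : List (Vertex G × Vertex G)
  edges = filter (λ (u , v) → (u <?ᶠ v) ×-dec T? (adj G u v))
                 (cartesianProduct (allFin (order G)) (allFin (order G)))

Endpoint : ∀ {n} → Fin n → Fin n × Fin n → Set
Endpoint w (u , v) = w ≡ u ⊎ w ≡ v

endpoint? : ∀ {n} (w : Fin n) e → Dec (Endpoint w e)
endpoint? w (u , v) = (w ≟ᶠ u) ⊎-dec (w ≟ᶠ v)

module _ (G : Graph) where

  LineAdj : Fin (length (edges G)) → Fin (length (edges G)) → Set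
  LineAdj i j = i ≢ j ×
    (∃ λ w → Endpoint w (lookup (edges G) i) × Endpoint w (lookup (edges G) j))

  lineAdj? : ∀ i j → Dec (LineAdj i j)
  lineAdj? i j = ¬? (i ≟ᶠ j) ×-dec
    any? (λ w → endpoint? w (lookup (edges G) i) ×-dec endpoint? w (lookup (edges G) j))

  lineGraph : Graph
  lineGraph .order = length (edges G)
  lineGraph .adj i j = ⌊ lineAdj? i j ⌋
  lineGraph .adj-sym {i} {j} t with toWitness {a? = lineAdj? i j} t
  ... | i≢j , w , p , q = fromWitness {a? = lineAdj? j i} (i≢j ∘ sym , w , q , p)
  lineGraph .adj-irrefl {i} t = proj₁ (toWitness {a? = lineAdj? i i} t) refl

------------------------------------------------------------------------
-- Fractional colouring

sumSubsets : ∀ n → (Subset n → ℚ) → ℚ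
sumSubsets zero    f = f []
sumSubsets (suc n) f =
  sumSubsets n (λ S → f (outside ∷ S)) + sumSubsets n (λ S → f (inside ∷ S))

-- Rational weights suffice: the infimum of the linear program is the same as
-- with real weights, because its data are rational.
record FractionalColouring (G : Graph) : Set where
  field
    weight      : Subset (order G) → ℚ
    nonneg      : ∀ S → 0ℚ ≤ weight S
    independent : ∀ S → ¬ Independent G S → weight S ≡ 0ℚ
    covers      : ∀ v →
      1ℚ ≤ sumSubsets (order G) (λ S → if does (v ∈? S) then weight S else 0ℚ)

  total : ℚ
  total = sumSubsets (order G) weight

χᶠ : Graph → Cut
χᶠ G = inf (FractionalColouring.total {G})

hᶠ : ℕ → Graph → Cut
hᶠ r G = max {I = Σ Graph λ H → H ⊆ᴳ G × Girth≥ H r} (χᶠ ∘ proj₁)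

------------------------------------------------------------------------
-- Generalized quadrangles and hexagons

record Geometry : Set where
  field
    #points  : ℕ
    #lines   : ℕ
    incident : Fin #points → Fin #lines → Bool

open Geometry public

module _ (𝒢 : Geometry) where

  flag : Fin (#points 𝒢) ⊎ Fin (#lines 𝒢) → Fin (#points 𝒢) ⊎ Fin (#lines 𝒢) → Bool
  flag (inj₁ p) (inj₂ l) = incident 𝒢 p l
  flag (inj₂ l) (inj₁ p) = incident 𝒢 p l
  flag (inj₁ _) (inj₁ _) = false
  flag (inj₂ _) (inj₂ _) = false

  flag-sym : ∀ x y → T (flag x y) → T (flag y x)
  flag-sym (inj₁ p) (inj₂ l) t = t
  flag-sym (inj₂ l) (inj₁ p) t = t

  flag-irrefl : ∀ x → ¬ T (flag x x)
  flag-irrefl (inj₁ _) ()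
  flag-irrefl (inj₂ _) ()

  incidenceGraph : Graph
  incidenceGraph .order = #points 𝒢 ℕ.+ #lines 𝒢
  incidenceGraph .adj u v = flag (splitAt (#points 𝒢) u) (splitAt (#points 𝒢) v)
  incidenceGraph .adj-sym {u} {v} = flag-sym (splitAt (#points 𝒢) u) (splitAt (#points 𝒢) v)
  incidenceGraph .adj-irrefl {u} = flag-irrefl (splitAt (#points 𝒢) u)

  HasOrder : ℕ → Set
  HasOrder s = (∀ l → ∣ tabulate (λ p → incident 𝒢 p l) ∣ ≡ suc s)
             × (∀ p → ∣ tabulate (λ l → incident 𝒢 p l) ∣ ≡ suc s)

data Kind : Set where
  quadrangle hexagon : Kind

diameterOf girthOf : Kind → ℕ
diameterOf quadrangle = 4
diameterOf hexagon    = 6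
girthOf quadrangle = 8
girthOf hexagon    = 12

IsGeneralized : Kind → Geometry → Set
IsGeneralized K 𝒢 = HasDiameter (incidenceGraph 𝒢) (diameterOf K)
                  × HasGirth (incidenceGraph 𝒢) (girthOf K)

record PolygonSequence (K : Kind) : Set where
  field
    geometry    : ℕ → Geometry
    s           : ℕ → ℕ
    generalized : ∀ i → IsGeneralized K (geometry i)
    hasOrder    : ∀ i → HasOrder (geometry i) (s i)
    s→∞         : ∀ M → ∃ λ N → ∀ i → N ℕ.≤ i → M ℕ.≤ s i

  B : ℕ → Graph
  B i = incidenceGraph (geometry i)

  Δ : ℕ → ℕ
  Δ i = suc (s i)

_→∞ : (ℕ → Cut) → Set
x →∞ = ∀ M → ∃ λ N → ∀ i → N ℕ.≤ i → fromℕᶜ M ≤ᶜ x i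

{-# OPTIONS --safe #-}
-- The edges at a vertex of B_s form a clique of size Δ in L(B_s), and subgraphs need not be induced, so
-- every graph with Δ vertices is a subgraph of L(B_s), and Erdős's probabilistic theorem for n = Δ suffices.
-- In a random graph on n vertices with edge probability d / n, the expected number of cycles with at most
-- g = r - 1 vertices is O (d ^ g), which is small compared to n, and with high probability every independent
-- set has O (n log n / d) vertices. Deleting the edges at one vertex of each short cycle leaves the
-- independence bound valid within the other vertices, of which there are at least n / 2, whence the
-- fractional chromatic number is at least of order d / log n. The strict inequality θ < 1 / (r - 1) leaves
-- room for this logarithm; of the factor 1 / log Δ in the claim only log Δ ≥ 1/2 is used.
module Submission where

open import Defs hiding (max) renaming (_^_ to _^ℚ_)
open import Algebra.Bundles using (module CommutativeMonoid)
open import Data.Bool.Base using (Bool; true; false; if_then_else_; T)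
open import Data.Bool.Properties using (T?; T-≡)
open import Data.Fin.Base as Fin using (Fin; zero; suc; combine; inject₁; fromℕ; splitAt; _↑ˡ_; _↑ʳ_)
import Data.Fin.Properties as Fin
open import Data.Fin.Subset as Subset using (Subset; inside; outside; ∣_∣)
open import Data.Fin.Subset.Properties using (_∈?_)
import Data.Integer.Base as ℤ
import Data.Integer.Properties as ℤ
open import Data.List.Base
  using (List; []; _∷_; map; concatMap; filter; length; _++_; replicate;
         allFin; upTo; mapMaybe; head; tabulate; take)
  renaming (lookup to lookupᴸ)
import Data.List.Membership.DecPropositional as DecMembership
open import Data.List.Membership.Propositional using (_∈_; _∉_; lose)
import Data.List.Membership.Propositional.Properties as ∈
import Data.List.Properties as List
open import Data.List.Relation.Binary.Subset.Propositional using (_⊆_)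
open import Data.List.Relation.Unary.All as All using (All; []; _∷_)
import Data.List.Relation.Unary.All.Properties as All
open import Data.List.Relation.Unary.AllPairs using ([]; _∷_)
open import Data.List.Relation.Unary.Any using (here; there; index)
import Data.List.Relation.Unary.Any.Properties as Any
open import Data.List.Relation.Unary.Unique.DecPropositional using (unique?)
open import Data.List.Relation.Unary.Unique.Propositional using (Unique)
import Data.List.Relation.Unary.Unique.Propositional.Properties as Unique
import Data.Maybe.Relation.Unary.Any as Maybe
open import Data.Nat.Base hiding (_/_)
open import Data.Nat.DivMod using (_/_; m/n*n≤m; m≡m%n+[m/n]*n; m%n<n)
open import Data.Nat.ListAction using (sum; product)
open import Data.Nat.ListAction.Properties using (sum-++)
open import Data.Nat.Properties
open import Data.Nat.Tactic.RingSolver using (solve-∀)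
open import Data.Product.Base using (Σ; ∃; ∃₂; _×_; _,_; proj₁; proj₂)
open import Data.Rational.Base as ℚ using (ℚ; 0ℚ; 1ℚ; mkℚ)
import Data.Rational.Properties as ℚ
import Data.Rational.Unnormalised.Base as ℚᵘ
import Data.Rational.Unnormalised.Properties as ℚᵘ
open import Data.Sum.Base using (_⊎_; inj₁; inj₂)
open import Data.Vec.Base as Vec using (Vec; []; _∷_; lookup; toList; fromList; _[_]≔_)
import Data.Vec.Properties as Vec
open import Function.Base using (_∘_; const)
open import Function.Bundles using (Equivalence)
open import Function.Definitions using (Injective)
open import Relation.Binary.Definitions using (tri<; tri≈; tri>)
open import Relation.Binary.PropositionalEquality
open import Relation.Nullary using (Dec; yes; no; ¬_; does; contradiction)
open import Relation.Nullary.Decidable using (_×-dec_; ¬?; toWitness; fromWitness; ⌊_⌋; dec-true; dec-false)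
open import Relation.Unary using (Decidable)

-- Probabilities are counts over all words of length n * n, and every estimate is cleared of
-- denominators, roots and subtractions, so that the random graph is analysed entirely in the
-- natural numbers. Logarithms enter this analysis only as a number L with 2 n ≤ 2 ^ L, and the real
-- exponent θ is replaced by a rational A / B strictly between θ and 1 / (r - 1).
--
-- Vertices on short cycles are isolated instead of removed, which keeps the vertex set `Fin n`. An
-- independent set may contain all isolated vertices, so the fractional chromatic number is bounded
-- by counting the cover of the remaining vertices only.
--
-- With g = r - 1, the inequality A g < B between integers leaves one whole factor n. It absorbs
-- every constant and every power of L once n is large; this is why no constant is optimised and why
-- c = 1 can be taken.

private variable
  X Y : Set
  n : ℕ

-- Sums over lists, and independence of the letters of a word

∑ : List X → (X → ℕ) → ℕ
∑ xs f = sum (map f xs)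

∑-cong : ∀ (xs : List X) {f g : X → ℕ} → (∀ x → f x ≡ g x) → ∑ xs f ≡ ∑ xs g
∑-cong xs f≗g = cong sum (List.map-cong f≗g xs)

∑-map : ∀ (h : X → Y) xs (f : Y → ℕ) → ∑ (map h xs) f ≡ ∑ xs (f ∘ h)
∑-map h xs f = cong sum (sym (List.map-∘ xs))

∑-++ : ∀ (xs ys : List X) f → ∑ (xs ++ ys) f ≡ ∑ xs f + ∑ ys f
∑-++ xs ys f = trans (cong sum (List.map-++ f xs ys)) (sum-++ (map f xs) (map f ys))

∑-concatMap : ∀ (h : X → List Y) xs (f : Y → ℕ) → ∑ (concatMap h xs) f ≡ ∑ xs (λ x → ∑ (h x) f)
∑-concatMap h []       f = refl
∑-concatMap h (x ∷ xs) f =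
  trans (∑-++ (h x) (concatMap h xs) f) (cong (∑ (h x) f +_) (∑-concatMap h xs f))

∑-+ : ∀ (xs : List X) f g → ∑ xs (λ x → f x + g x) ≡ ∑ xs f + ∑ xs g
∑-+ []       f g = refl
∑-+ (x ∷ xs) f g = trans (cong (f x + g x +_) (∑-+ xs f g)) (shuffle (f x) (g x) (∑ xs f) (∑ xs g))
  where
  shuffle : ∀ a b c d → a + b + (c + d) ≡ a + c + (b + d)
  shuffle = solve-∀

∑-*ˡ : ∀ (xs : List X) c f → ∑ xs (λ x → c * f x) ≡ c * ∑ xs f
∑-*ˡ []       c f = sym (*-zeroʳ c)
∑-*ˡ (x ∷ xs) c f = trans (cong (c * f x +_) (∑-*ˡ xs c f)) (sym (*-distribˡ-+ c (f x) (∑ xs f)))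

∑-*ʳ : ∀ (xs : List X) c f → ∑ xs (λ x → f x * c) ≡ ∑ xs f * c
∑-*ʳ xs c f = trans (∑-cong xs (λ x → *-comm (f x) c)) (trans (∑-*ˡ xs c f) (*-comm c _))

∑-const : ∀ (xs : List X) c → ∑ xs (const c) ≡ length xs * c
∑-const []       c = refl
∑-const (x ∷ xs) c = cong (c +_) (∑-const xs c)

∑-swap : ∀ (xs : List X) (ys : List Y) (f : X → Y → ℕ) →
  ∑ xs (λ x → ∑ ys (f x)) ≡ ∑ ys (λ y → ∑ xs (λ x → f x y))
∑-swap []       ys f = sym (trans (∑-const ys 0) (*-zeroʳ (length ys)))
∑-swap (x ∷ xs) ys f =
  trans (cong (∑ ys (f x) +_) (∑-swap xs ys f)) (sym (∑-+ ys (f x) (λ y → ∑ xs (λ x → f x y))))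

∑-bounded : ∀ (xs : List X) {f : X → ℕ} {M} → (∀ {x} → x ∈ xs → f x ≤ M) → ∑ xs f ≤ length xs * M
∑-bounded []       f≤M = z≤n
∑-bounded (x ∷ xs) f≤M = +-mono-≤ (f≤M (here refl)) (∑-bounded xs (f≤M ∘ there))

∑-below-average : ∀ (xs : List X) (f : X → ℕ) M → ∑ xs f < length xs * M → ∃ λ x → f x < M
∑-below-average (x ∷ xs) f M lt with f x <? M
... | yes fx<M = x , fx<M
... | no  fx≮M = ∑-below-average xs f M
  (+-cancelˡ-< M _ _ (≤-<-trans (+-monoˡ-≤ (∑ xs f) (≮⇒≥ fx≮M)) lt))

∑≡0⇒≡0 : ∀ (xs : List X) (f : X → ℕ) → ∑ xs f ≡ 0 → ∀ {x} → x ∈ xs → f x ≡ 0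
∑≡0⇒≡0 (x ∷ xs) f eq (here refl) = m+n≡0⇒m≡0 (f x) eq
∑≡0⇒≡0 (x ∷ xs) f eq (there x∈)  = ∑≡0⇒≡0 xs f (m+n≡0⇒n≡0 (f x) eq) x∈

length-filter≤∑ : ∀ {P : X → Set} (P? : Decidable P) (f : X → ℕ) → (∀ {x} → P x → 1 ≤ f x) →
  ∀ xs → length (filter P? xs) ≤ ∑ xs f
length-filter≤∑ P? f P⇒1≤f []       = z≤n
length-filter≤∑ P? f P⇒1≤f (x ∷ xs) with P? x
... | yes Px = +-mono-≤ (P⇒1≤f Px) (length-filter≤∑ P? f P⇒1≤f xs)
... | no  _  = ≤-trans (length-filter≤∑ P? f P⇒1≤f xs) (m≤n+m _ (f x))

-- Repeated letters of `xs` produce repeated words, so plain counting also covers products of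
-- non-uniform distributions with rational weights.
words : List X → ∀ k → List (Vec X k)
words xs zero    = [] ∷ []
words xs (suc k) = concatMap (λ x → map (x ∷_) (words xs k)) xs

∑-words-suc : ∀ (xs : List X) k (f : Vec X (suc k) → ℕ) →
  ∑ (words xs (suc k)) f ≡ ∑ xs (λ x → ∑ (words xs k) (λ w → f (x ∷ w)))
∑-words-suc xs k f =
  trans (∑-concatMap _ xs f) (∑-cong xs (λ x → ∑-map (x ∷_) (words xs k) f))

length-as-∑ : ∀ (xs : List X) → ∑ xs (const 1) ≡ length xs
length-as-∑ xs = trans (∑-const xs 1) (*-identityʳ _)

length-words : ∀ (xs : List X) k → length (words xs k) ≡ length xs ^ k
length-words xs zero    = refl
length-words xs (suc k) = begin
  length (words xs (suc k))           ≡⟨ length-as-∑ (words xs (suc k)) ⟨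
  ∑ (words xs (suc k)) (const 1)      ≡⟨ ∑-words-suc xs k (const 1) ⟩
  ∑ xs (λ _ → ∑ (words xs k) (const 1)) ≡⟨ ∑-const xs _ ⟩
  length xs * ∑ (words xs k) (const 1) ≡⟨ cong (length xs *_)
                                              (trans (length-as-∑ (words xs k)) (length-words xs k)) ⟩
  length xs ^ suc k                   ∎
  where open ≡-Reasoning

∈-words : ∀ {xs : List X} ys → All (_∈ xs) ys → fromList ys ∈ words xs (length ys)
∈-words []       []         = here refl
∈-words {xs = xs} (y ∷ ys) (y∈ ∷ ys∈) =
  ∈.∈-concatMap⁺ (λ x → map (x ∷_) (words xs (length ys)))
    (lose y∈ (∈.∈-map⁺ (y ∷_) (∈-words ys ys∈)))

-- Overwriting one letter by a uniform one preserves the uniform distribution. This isolates the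
-- letter at an arbitrary position `s` without cutting the word there.
∑-resample : ∀ (xs : List X) {N} (s : Fin N) (F : Vec X N → ℕ) →
  ∑ (words xs N) (λ ω → ∑ xs (λ z → F (ω [ s ]≔ z))) ≡ length xs * ∑ (words xs N) F
∑-resample xs {suc N} zero F = begin
  ∑ (words xs (suc N)) (λ ω → ∑ xs (λ z → F (ω [ zero ]≔ z)))
    ≡⟨ ∑-words-suc xs N _ ⟩
  ∑ xs (λ _ → ∑ (words xs N) (λ ω → ∑ xs (λ z → F (z ∷ ω))))
    ≡⟨ ∑-const xs _ ⟩
  length xs * ∑ (words xs N) (λ ω → ∑ xs (λ z → F (z ∷ ω)))
    ≡⟨ cong (length xs *_) (∑-swap (words xs N) xs _) ⟩
  length xs * ∑ xs (λ z → ∑ (words xs N) (λ ω → F (z ∷ ω)))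
    ≡⟨ cong (length xs *_) (∑-words-suc xs N F) ⟨
  length xs * ∑ (words xs (suc N)) F ∎
  where open ≡-Reasoning
∑-resample xs {suc N} (suc s) F = begin
  ∑ (words xs (suc N)) (λ ω → ∑ xs (λ z → F (ω [ suc s ]≔ z)))
    ≡⟨ ∑-words-suc xs N _ ⟩
  ∑ xs (λ x → ∑ (words xs N) (λ ω → ∑ xs (λ z → F (x ∷ (ω [ s ]≔ z)))))
    ≡⟨ ∑-cong xs (λ x → ∑-resample xs s (F ∘ (x ∷_))) ⟩
  ∑ xs (λ x → length xs * ∑ (words xs N) (λ ω → F (x ∷ ω)))
    ≡⟨ ∑-*ˡ xs (length xs) _ ⟩
  length xs * ∑ xs (λ x → ∑ (words xs N) (λ ω → F (x ∷ ω)))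
    ≡⟨ cong (length xs *_) (∑-words-suc xs N F) ⟨
  length xs * ∑ (words xs (suc N)) F ∎
  where open ≡-Reasoning

-- For `f` equal to `present` or `absent`, the indicator of the event that all letters at `L` are
-- true, or all are false.
letterProduct : ∀ {N} → (X → ℕ) → List (Fin N) → Vec X N → ℕ
letterProduct f L ω = product (map (f ∘ lookup ω) L)

letterProduct-fresh : ∀ {N} (f : X → ℕ) {s : Fin N} {L} → All (s ≢_) L → ∀ ω z →
  letterProduct f L (ω [ s ]≔ z) ≡ letterProduct f L ω
letterProduct-fresh f []         ω z = refl
letterProduct-fresh f (s≢ ∷ s∉L) ω z =
  cong₂ _*_ (cong f (Vec.lookup∘update′ (s≢ ∘ sym) ω z)) (letterProduct-fresh f s∉L ω z)

-- Letters at distinct positions are independent: after division by (length xs) ^ (N + length L),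
-- the expectation of a product is the product of the expectations.
∑-letterProduct : ∀ (xs : List X) {N} (f : X → ℕ) {L : List (Fin N)} → Unique L →
  length xs ^ length L * ∑ (words xs N) (letterProduct f L) ≡ ∑ xs f ^ length L * length xs ^ N
∑-letterProduct xs {N} f []  = cong (1 *_) (trans (length-as-∑ (words xs N)) (length-words xs N))
∑-letterProduct xs {N} f {s ∷ L} (s∉L ∷ L!) = begin
  n′ * n′ ^ k * ∑ Ω (letterProduct f (s ∷ L))
    ≡⟨ rotate n′ (n′ ^ k) _ ⟩
  n′ ^ k * (n′ * ∑ Ω (letterProduct f (s ∷ L)))
    ≡⟨ cong (n′ ^ k *_) (∑-resample xs s (letterProduct f (s ∷ L))) ⟨
  n′ ^ k * ∑ Ω (λ ω → ∑ xs (λ z → letterProduct f (s ∷ L) (ω [ s ]≔ z)))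
    ≡⟨ cong (n′ ^ k *_) (∑-cong Ω λ ω → ∑-cong xs λ z →
         cong₂ _*_ (cong f (Vec.lookup∘update s ω z)) (letterProduct-fresh f s∉L ω z)) ⟩
  n′ ^ k * ∑ Ω (λ ω → ∑ xs (λ z → f z * letterProduct f L ω))
    ≡⟨ cong (n′ ^ k *_) (∑-cong Ω λ ω → ∑-*ʳ xs (letterProduct f L ω) f) ⟩
  n′ ^ k * ∑ Ω (λ ω → ∑ xs f * letterProduct f L ω)
    ≡⟨ cong (n′ ^ k *_) (∑-*ˡ Ω (∑ xs f) (letterProduct f L)) ⟩
  n′ ^ k * (∑ xs f * ∑ Ω (letterProduct f L))
    ≡⟨ swap (n′ ^ k) (∑ xs f) _ ⟩
  ∑ xs f * (n′ ^ k * ∑ Ω (letterProduct f L))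
    ≡⟨ cong (∑ xs f *_) (∑-letterProduct xs f L!) ⟩
  ∑ xs f * (∑ xs f ^ k * n′ ^ N)
    ≡⟨ *-assoc (∑ xs f) _ _ ⟨
  ∑ xs f * ∑ xs f ^ k * n′ ^ N ∎
  where
  open ≡-Reasoning
  n′ = length xs
  k = length L
  Ω = words xs N
  rotate : ∀ a b c → a * b * c ≡ b * (a * c)
  rotate = solve-∀
  swap : ∀ a b c → a * (b * c) ≡ b * (a * c)
  swap = solve-∀

-- Slots of pairs, paths and cycles

-- Both orders of a pair read the same letter. Positions that are no slot are never read and do not
-- affect averages; allowing them spares a numbering of the unordered pairs.
slot : Fin n → Fin n → Fin (n * n)
slot u v = if does (u Fin.<? v) then combine u v else combine v u

slot-cases : (u v : Fin n) → slot u v ≡ combine u v ⊎ slot u v ≡ combine v u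
slot-cases u v with does (u Fin.<? v)
... | true  = inj₁ refl
... | false = inj₂ refl

slot-sym : (u v : Fin n) → slot u v ≡ slot v u
slot-sym u v with Fin.<-cmp u v
... | tri< u<v _ v≮u rewrite dec-true (u Fin.<? v) u<v | dec-false (v Fin.<? u) v≮u = refl
... | tri≈ _ refl _  = refl
... | tri> u≮v _ v<u rewrite dec-false (u Fin.<? v) u≮v | dec-true (v Fin.<? u) v<u = refl

slot-injective : (u v u′ v′ : Fin n) → slot u v ≡ slot u′ v′ →
  (u ≡ u′ × v ≡ v′) ⊎ (u ≡ v′ × v ≡ u′)
slot-injective u v u′ v′ eq with slot-cases u v | slot-cases u′ v′
... | inj₁ p | inj₁ q = inj₁ (Fin.combine-injective u v u′ v′ (trans (sym p) (trans eq q)))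
... | inj₁ p | inj₂ q = inj₂ (Fin.combine-injective u v v′ u′ (trans (sym p) (trans eq q)))
... | inj₂ p | inj₁ q with Fin.combine-injective v u u′ v′ (trans (sym p) (trans eq q))
...   | v≡u′ , u≡v′ = inj₂ (u≡v′ , v≡u′)
slot-injective u v u′ v′ eq | inj₂ p | inj₂ q
  with Fin.combine-injective v u v′ u′ (trans (sym p) (trans eq q))
...   | v≡v′ , u≡u′ = inj₁ (u≡u′ , v≡v′)

slot-injectiveʳ : ∀ {u v v′ : Fin n} → slot u v ≡ slot u v′ → v ≡ v′
slot-injectiveʳ {u = u} {v} {v′} eq with slot-injective u v u v′ eq
... | inj₁ (_ , v≡v′)     = v≡v′
... | inj₂ (u≡v′ , v≡u) = trans v≡u u≡v′

pairSlots : List (Fin n) → List (Fin (n * n))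
pairSlots []       = []
pairSlots (x ∷ xs) = map (slot x) xs ++ pairSlots xs

∈-pairSlots⁻ : ∀ {s} (xs : List (Fin n)) → Unique xs → s ∈ pairSlots xs →
  ∃₂ λ u v → u ∈ xs × v ∈ xs × u ≢ v × s ≡ slot u v
∈-pairSlots⁻ (x ∷ xs) (x∉ ∷ xs!) s∈ with ∈.∈-++⁻ (map (slot x) xs) s∈
... | inj₁ s∈₁ with ∈.∈-map⁻ (slot x) s∈₁
...   | v , v∈ , s≡ = x , v , here refl , there v∈ , All.lookup x∉ v∈ , s≡
∈-pairSlots⁻ (x ∷ xs) (x∉ ∷ xs!) s∈ | inj₂ s∈₂ with ∈-pairSlots⁻ xs xs! s∈₂
...   | u , v , u∈ , v∈ , u≢v , s≡ = u , v , there u∈ , there v∈ , u≢v , s≡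

pairSlots-unique : ∀ {xs : List (Fin n)} → Unique xs → Unique (pairSlots xs)
pairSlots-unique []                  = []
pairSlots-unique {xs = x ∷ xs} (x∉ ∷ xs!) =
  Unique.++⁺ (Unique.map⁺ slot-injectiveʳ xs!) (pairSlots-unique xs!) disjoint
  where
  disjoint : ∀ {s} → ¬ (s ∈ map (slot x) xs × s ∈ pairSlots xs)
  disjoint (s∈₁ , s∈₂) with ∈.∈-map⁻ (slot x) s∈₁ | ∈-pairSlots⁻ xs xs! s∈₂
  ... | y , _ , refl | u , v , u∈ , v∈ , _ , eq with slot-injective x y u v eq
  ...   | inj₁ (x≡u , _) = All.lookup x∉ u∈ x≡u
  ...   | inj₂ (x≡v , _) = All.lookup x∉ v∈ x≡v

-- The binomial coefficient k (k - 1) / 2, free of division and truncated subtraction.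
length-pairSlots : ∀ (xs : List (Fin n)) →
  2 * length (pairSlots xs) + length xs ≡ length xs * length xs
length-pairSlots []       = refl
length-pairSlots (x ∷ xs) = begin
  2 * length (map (slot x) xs ++ pairSlots xs) + suc k
    ≡⟨ cong (λ m → 2 * m + suc k) (trans (List.length-++ (map (slot x) xs))
         (cong (_+ length (pairSlots xs)) (List.length-map (slot x) xs))) ⟩
  2 * (k + length (pairSlots xs)) + suc k
    ≡⟨ expand k (length (pairSlots xs)) ⟩
  suc (2 * k) + (2 * length (pairSlots xs) + k)
    ≡⟨ cong (suc (2 * k) +_) (length-pairSlots xs) ⟩
  suc (2 * k) + k * k
    ≡⟨ square k ⟩
  suc k * suc k ∎
  where
  open ≡-Reasoning
  k = length xs
  expand : ∀ k p → 2 * (k + p) + suc k ≡ suc (2 * k) + (2 * p + k)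
  expand = solve-∀
  square : ∀ k → suc (2 * k) + k * k ≡ suc k * suc k
  square = solve-∀

pathSlots : Fin n → List (Fin n) → Fin n → List (Fin (n * n))
pathSlots x []       z = slot x z ∷ []
pathSlots x (y ∷ ys) z = slot x y ∷ pathSlots y ys z

length-pathSlots : ∀ (x : Fin n) ys z → length (pathSlots x ys z) ≡ suc (length ys)
length-pathSlots x []       z = refl
length-pathSlots x (y ∷ ys) z = cong suc (length-pathSlots y ys z)

slot∉pathSlots : ∀ {w : Fin n} v x ys z → w ≢ x → All (w ≢_) ys → w ≢ z →
  All (slot w v ≢_) (pathSlots x ys z)
slot∉pathSlots {w = w} v x [] z w≢x [] w≢z = notHere ∷ []
  where
  notHere : slot w v ≢ slot x z
  notHere eq with slot-injective w v x z eq
  ... | inj₁ (w≡x , _) = w≢x w≡x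
  ... | inj₂ (w≡z , _) = w≢z w≡z
slot∉pathSlots {w = w} v x (y ∷ ys) z w≢x (w≢y ∷ w∉ys) w≢z =
  notHere ∷ slot∉pathSlots v y ys z w≢y w∉ys w≢z
  where
  notHere : slot w v ≢ slot x y
  notHere eq with slot-injective w v x y eq
  ... | inj₁ (w≡x , _) = w≢x w≡x
  ... | inj₂ (w≡y , _) = w≢y w≡y

pathSlots-unique : ∀ (x : Fin n) ys z → Unique (x ∷ ys) → All (z ≢_) (x ∷ ys) →
  Unique (pathSlots x ys z)
pathSlots-unique x []       z _ _ = [] ∷ []
pathSlots-unique x (y ∷ ys) z ((x≢y ∷ x∉ys) ∷ ys!) (z≢x ∷ z∉) =
  slot∉pathSlots y y ys z x≢y x∉ys (z≢x ∘ sym) ∷ pathSlots-unique y ys z ys! z∉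

-- From the third slot on, the path avoids `y`, hence `slot x y`; the second slot `slot y w` avoids
-- `x`. The bound 2 excludes the closed walk on two vertices, which uses its slot twice.
cycleSlots-unique : ∀ (x : Fin n) ys → 2 ≤ length ys → Unique (x ∷ ys) →
  Unique (pathSlots x ys x)
cycleSlots-unique x (y ∷ [])     (s≤s ())
cycleSlots-unique x (y ∷ w ∷ ws) _ ((x≢y ∷ x≢w ∷ x∉ws) ∷ (y≢w ∷ y∉ws) ∷ ws!) =
  (notHere ∷ subst (λ s → All (s ≢_) (pathSlots w ws x)) (slot-sym y x)
    (slot∉pathSlots x w ws x y≢w y∉ws (x≢y ∘ sym)))
  ∷ pathSlots-unique y (w ∷ ws) x ((y≢w ∷ y∉ws) ∷ ws!) (x≢y ∷ x≢w ∷ x∉ws)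
  where
  notHere : slot x y ≢ slot y w
  notHere eq with slot-injective x y y w eq
  ... | inj₁ (x≡y , _) = x≢y x≡y
  ... | inj₂ (x≡w , _) = x≢w x≡w

-- The random graph and expected numbers of configurations

present absent : Bool → ℕ
present b = if b then 1 else 0
absent  b = if b then 0 else 1

-- X uniformly random letter is true with probability d / (d + c); a word of length n * n over this
-- alphabet, read at the slots, is a random graph on n vertices.
letters : ℕ → ℕ → List Bool
letters d c = replicate d true ++ replicate c false

length-letters : ∀ d c → length (letters d c) ≡ d + c
length-letters d c = trans (List.length-++ (replicate d true))
  (cong₂ _+_ (List.length-replicate d) (List.length-replicate c))

∑-letters : ∀ d c f → ∑ (letters d c) f ≡ d * f true + c * f false
∑-letters d c f = trans (∑-++ (replicate d true) _ f) (cong₂ _+_ (∑-replicate d true) (∑-replicate c false))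
  where
  ∑-replicate : ∀ k b → ∑ (replicate k b) f ≡ k * f b
  ∑-replicate zero    b = refl
  ∑-replicate (suc k) b = cong (f b +_) (∑-replicate k b)

∑-present : ∀ d c → ∑ (letters d c) present ≡ d
∑-present d c = trans (∑-letters d c present) (trans (cong₂ _+_ (*-identityʳ d) (*-zeroʳ c)) (+-identityʳ d))

∑-absent : ∀ d c → ∑ (letters d c) absent ≡ c
∑-absent d c = trans (∑-letters d c absent) (cong₂ _+_ (*-zeroʳ d) (*-identityʳ c))

-- Linearity of expectation: each configuration consists of `k` distinct positions, so its
-- expectation is the `k`-th power of that of a single letter.
∑-configurations : ∀ (xs : List X) {N} (f : X → ℕ) (cs : List Y) (slots : Y → List (Fin N)) k →
  (∀ {c} → c ∈ cs → Unique (slots c) × length (slots c) ≡ k) →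
  length xs ^ k * ∑ (words xs N) (λ ω → ∑ cs (λ c → letterProduct f (slots c) ω)) ≤
    length cs * (∑ xs f ^ k * length xs ^ N)
∑-configurations xs {N} f cs slots k slots-ok = begin
  length xs ^ k * ∑ Ω (λ ω → ∑ cs (λ c → letterProduct f (slots c) ω))
    ≡⟨ cong (length xs ^ k *_) (∑-swap Ω cs _) ⟩
  length xs ^ k * ∑ cs (λ c → ∑ Ω (letterProduct f (slots c)))
    ≡⟨ ∑-*ˡ cs (length xs ^ k) _ ⟨
  ∑ cs (λ c → length xs ^ k * ∑ Ω (letterProduct f (slots c)))
    ≤⟨ ∑-bounded cs (λ c∈ → ≤-reflexive (each c∈)) ⟩
  length cs * (∑ xs f ^ k * length xs ^ N) ∎
  where
  open ≤-Reasoning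
  Ω = words xs N
  each : ∀ {c} → c ∈ cs →
    length xs ^ k * ∑ Ω (letterProduct f (slots c)) ≡ ∑ xs f ^ k * length xs ^ N
  each c∈ with slots-ok c∈
  ... | unique , refl = ∑-letterProduct xs f unique

-- The first moment

lists : ∀ n → ℕ → List (List (Fin n))
lists n k = map toList (words (allFin n) k)

length-lists : ∀ n k → length (lists n k) ≡ n ^ k
length-lists n k = trans (List.length-map toList (words (allFin n) k))
  (trans (length-words (allFin n) k) (cong (_^ k) (List.length-tabulate {n = n} (λ i → i))))

∈-lists⁺ : ∀ (xs : List (Fin n)) → xs ∈ lists n (length xs)
∈-lists⁺ {n} xs = subst (_∈ lists n (length xs)) (Vec.toList∘fromList xs)
  (∈.∈-map⁺ toList (∈-words xs (All.universal ∈.∈-allFin xs)))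

∈-lists⁻ : ∀ {k} {xs : List (Fin n)} → xs ∈ lists n k → length xs ≡ k
∈-lists⁻ {n} {k} xs∈ with ∈.∈-map⁻ toList xs∈
... | v , _ , refl = Vec.length-toList v

-- Ordered lists stand for vertex sets. The overcount is harmless: only the vanishing of the number
-- of independent ones is used, and n ^ k bounds the number of lists anyway.
distinctLists : ∀ n → ℕ → List (List (Fin n))
distinctLists n k = filter (unique? Fin._≟_) (lists n k)

closedSlots : List (Fin n) → List (Fin (n * n))
closedSlots []       = []
closedSlots (x ∷ xs) = pathSlots x xs x

IsCycleList : List (Fin n) → Set
IsCycleList xs = 3 ≤ length xs × Unique xs

isCycleList? : Decidable (IsCycleList {n})
isCycleList? xs = (3 ≤? length xs) ×-dec unique? Fin._≟_ xs

closedSlots-unique : ∀ {xs : List (Fin n)} → IsCycleList xs → Unique (closedSlots xs)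
closedSlots-unique {xs = x ∷ xs} (s≤s 2≤ , xs!) = cycleSlots-unique x xs 2≤ xs!

length-closedSlots : ∀ {xs : List (Fin n)} → IsCycleList xs → length (closedSlots xs) ≡ length xs
length-closedSlots {xs = x ∷ xs} _ = length-pathSlots x xs x

cycleLists : ∀ n → ℕ → List (List (Fin n))
cycleLists n k = filter isCycleList? (lists n k)

shortCycleLists : ∀ n → ℕ → List (List (Fin n))
shortCycleLists n g = concatMap (cycleLists n) (upTo (suc g))

Closed : ∀ n → Vec Bool (n * n) → List (Fin n) → Set
Closed n ω xs = 1 ≤ letterProduct present (closedSlots {n} xs) ω

closed? : ∀ n ω → Decidable (Closed n ω)
closed? n ω xs = 1 ≤? letterProduct present (closedSlots {n} xs) ω

shortCycles : ∀ n → ℕ → Vec Bool (n * n) → List (List (Fin n))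
shortCycles n g ω = filter (closed? n ω) (shortCycleLists n g)

#independent : ∀ n → ℕ → Vec Bool (n * n) → ℕ
#independent n a ω = ∑ (distinctLists n a) (λ xs → letterProduct absent (pairSlots xs) ω)

#cycles : ∀ n → ℕ → Vec Bool (n * n) → ℕ
#cycles n k ω = ∑ (cycleLists n k) (λ xs → letterProduct present (closedSlots xs) ω)

module _ (d c : ℕ) where

  private
    n′ = d + c
    Ω  = words (letters d c) (n′ * n′)
    |Ω| = n′ ^ (n′ * n′)

  ∑-#independent : ∀ a T → 2 * T + a ≡ a * a → n′ ^ T * ∑ Ω (#independent n′ a) ≤ n′ ^ a * c ^ T * |Ω|
  ∑-#independent a T 2T+a≡a² = begin
    n′ ^ T * ∑ Ω (#independent n′ a)
      ≡⟨ cong (λ m → m ^ T * ∑ Ω (#independent n′ a)) (length-letters d c) ⟨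
    length (letters d c) ^ T * ∑ Ω (#independent n′ a)
      ≤⟨ ∑-configurations (letters d c) absent (distinctLists n′ a) pairSlots T slots-ok ⟩
    length (distinctLists n′ a) * (∑ (letters d c) absent ^ T * length (letters d c) ^ (n′ * n′))
      ≡⟨ cong₂ (λ x y → length (distinctLists n′ a) * (x ^ T * y ^ (n′ * n′)))
           (∑-absent d c) (length-letters d c) ⟩
    length (distinctLists n′ a) * (c ^ T * |Ω|)
      ≤⟨ *-monoˡ-≤ _ (≤-trans (List.length-filter (unique? Fin._≟_) (lists n′ a))
           (≤-reflexive (length-lists n′ a))) ⟩
    n′ ^ a * (c ^ T * |Ω|)
      ≡⟨ *-assoc (n′ ^ a) _ _ ⟨
    n′ ^ a * c ^ T * |Ω| ∎
    where
    open ≤-Reasoning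
    slots-ok : ∀ {xs} → xs ∈ distinctLists n′ a →
      Unique (pairSlots xs) × length (pairSlots xs) ≡ T
    slots-ok {xs} xs∈ with ∈.∈-filter⁻ (unique? Fin._≟_) {xs = lists n′ a} xs∈
    ... | xs∈lists , xs! with ∈-lists⁻ xs∈lists
    ...   | refl = pairSlots-unique xs! ,
      *-cancelˡ-≡ _ _ 2 (+-cancelʳ-≡ (length xs) _ _ (trans (length-pairSlots xs) (sym 2T+a≡a²)))

  -- At most n ^ k lists, each closed with probability (d / n) ^ k: the powers of n cancel.
  ∑-#cycles : .{{_ : NonZero d}} → ∀ k → ∑ Ω (#cycles n′ k) ≤ d ^ k * |Ω|
  ∑-#cycles k = *-cancelˡ-≤ (n′ ^ k) {{m^n≢0 n′ k {{d+c≢0}}}} (begin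
    n′ ^ k * ∑ Ω (#cycles n′ k)
      ≡⟨ cong (λ m → m ^ k * ∑ Ω (#cycles n′ k)) (length-letters d c) ⟨
    length (letters d c) ^ k * ∑ Ω (#cycles n′ k)
      ≤⟨ ∑-configurations (letters d c) present (cycleLists n′ k) closedSlots k slots-ok ⟩
    length (cycleLists n′ k) * (∑ (letters d c) present ^ k * length (letters d c) ^ (n′ * n′))
      ≡⟨ cong₂ (λ x y → length (cycleLists n′ k) * (x ^ k * y ^ (n′ * n′)))
           (∑-present d c) (length-letters d c) ⟩
    length (cycleLists n′ k) * (d ^ k * |Ω|)
      ≤⟨ *-monoˡ-≤ _ (≤-trans (List.length-filter isCycleList? (lists n′ k))
           (≤-reflexive (length-lists n′ k))) ⟩
    n′ ^ k * (d ^ k * |Ω|) ∎)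
    where
    open ≤-Reasoning
    d+c≢0 : NonZero n′
    d+c≢0 = >-nonZero (≤-trans (>-nonZero⁻¹ d) (m≤m+n d c))
    slots-ok : ∀ {xs} → xs ∈ cycleLists n′ k →
      Unique (closedSlots xs) × length (closedSlots xs) ≡ k
    slots-ok {xs} xs∈ with ∈.∈-filter⁻ isCycleList? {xs = lists n′ k} xs∈
    ... | xs∈lists , cyc = closedSlots-unique cyc ,
      trans (length-closedSlots cyc) (∈-lists⁻ xs∈lists)

  -- One averaging serves both requirements. Independent lists have expected number at most 1/2 and
  -- short cycles less than K / 2, so counting each independent list with weight K keeps the average
  -- below K.
  firstMoment : .{{_ : NonZero d}} → ∀ g a T K → 2 * T + a ≡ a * a →
    2 * (n′ ^ a * c ^ T) ≤ n′ ^ T → 2 * (suc g * d ^ g) < K →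
    ∃ λ ω → #independent n′ a ω ≡ 0 × length (shortCycles n′ g ω) < K
  firstMoment g a T K 2T+a≡a² few-independent K-large =
    conclude (∑-below-average Ω score K average)
    where
    open ≤-Reasoning
    n^≢0 : ∀ k → NonZero (n′ ^ k)
    n^≢0 k = m^n≢0 n′ k {{>-nonZero (≤-trans (>-nonZero⁻¹ d) (m≤m+n d c))}}

    cycles : Vec Bool (n′ * n′) → ℕ
    cycles ω = ∑ (upTo (suc g)) (λ k → #cycles n′ k ω)

    independent≤ : 2 * ∑ Ω (#independent n′ a) ≤ |Ω|
    independent≤ = *-cancelˡ-≤ (n′ ^ T) {{n^≢0 T}} (begin
      n′ ^ T * (2 * ∑ Ω (#independent n′ a)) ≡⟨ rearrange (n′ ^ T) _ ⟩
      2 * (n′ ^ T * ∑ Ω (#independent n′ a)) ≤⟨ *-monoʳ-≤ 2 (∑-#independent a T 2T+a≡a²) ⟩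
      2 * (n′ ^ a * c ^ T * |Ω|)          ≡⟨ *-assoc 2 (n′ ^ a * c ^ T) |Ω| ⟨
      2 * (n′ ^ a * c ^ T) * |Ω|          ≤⟨ *-monoˡ-≤ |Ω| few-independent ⟩
      n′ ^ T * |Ω|                        ∎)
      where
      rearrange : ∀ x y → x * (2 * y) ≡ 2 * (x * y)
      rearrange = solve-∀

    cycles≤ : ∑ Ω cycles ≤ suc g * (d ^ g * |Ω|)
    cycles≤ = begin
      ∑ Ω cycles                                 ≡⟨ ∑-swap Ω (upTo (suc g)) (λ ω k → #cycles n′ k ω) ⟩
      ∑ (upTo (suc g)) (λ k → ∑ Ω (#cycles n′ k))   ≤⟨ ∑-bounded (upTo (suc g)) each ⟩
      length (upTo (suc g)) * (d ^ g * |Ω|)      ≡⟨ cong (_* (d ^ g * |Ω|)) (List.length-upTo (suc g)) ⟩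
      suc g * (d ^ g * |Ω|)                      ∎
      where
      each : ∀ {k} → k ∈ upTo (suc g) → ∑ Ω (#cycles n′ k) ≤ d ^ g * |Ω|
      each {k} k∈ = ≤-trans (∑-#cycles k)
        (*-monoˡ-≤ |Ω| (^-monoʳ-≤ d (s≤s⁻¹ (∈.∈-upTo⁻ k∈))))

    -- X word scoring less than K has no independent list of length a and fewer than K short cycles.
    score : Vec Bool (n′ * n′) → ℕ
    score ω = K * #independent n′ a ω + cycles ω

    average : ∑ Ω score < length Ω * K
    average = *-cancelˡ-< 2 _ _ (begin-strict
      2 * ∑ Ω score
        ≡⟨ cong (2 *_) (trans (∑-+ Ω (λ ω → K * #independent n′ a ω) cycles)
             (cong (_+ ∑ Ω cycles) (∑-*ˡ Ω K (#independent n′ a)))) ⟩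
      2 * (K * ∑ Ω (#independent n′ a) + ∑ Ω cycles)
        ≡⟨ rearrange K _ _ ⟩
      K * (2 * ∑ Ω (#independent n′ a)) + 2 * ∑ Ω cycles
        ≤⟨ +-mono-≤ (*-monoʳ-≤ K independent≤) (*-monoʳ-≤ 2 cycles≤) ⟩
      K * |Ω| + 2 * (suc g * (d ^ g * |Ω|))
        ≡⟨ cong (K * |Ω| +_) (reassoc (suc g) (d ^ g) |Ω|) ⟩
      K * |Ω| + 2 * (suc g * d ^ g) * |Ω|
        <⟨ +-monoʳ-< (K * |Ω|) (*-monoˡ-< |Ω| {{n^≢0 (n′ * n′)}} K-large) ⟩
      K * |Ω| + K * |Ω|
        ≡⟨ double K |Ω| ⟩
      2 * (|Ω| * K)
        ≡⟨ cong (λ m → 2 * (m * K)) (trans (length-words (letters d c) (n′ * n′))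
             (cong (_^ (n′ * n′)) (length-letters d c))) ⟨
      2 * (length Ω * K) ∎)
      where
      rearrange : ∀ k x y → 2 * (k * x + y) ≡ k * (2 * x) + 2 * y
      rearrange = solve-∀
      reassoc : ∀ x y z → 2 * (x * (y * z)) ≡ 2 * (x * y) * z
      reassoc = solve-∀
      double : ∀ x y → x * y + x * y ≡ 2 * (y * x)
      double = solve-∀

    independent≡0 : ∀ ω → score ω < K → #independent n′ a ω ≡ 0
    independent≡0 ω lt = n<1⇒n≡0 (*-cancelˡ-< K _ 1 (begin-strict
      K * #independent n′ a ω ≤⟨ m≤m+n _ (cycles ω) ⟩
      score ω              <⟨ lt ⟩
      K                    ≡⟨ *-identityʳ K ⟨
      K * 1                ∎))

    cycles<K : ∀ ω → score ω < K → length (shortCycles n′ g ω) < K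
    cycles<K ω lt = begin-strict
      length (shortCycles n′ g ω)
        ≤⟨ length-filter≤∑ (closed? n′ ω) (λ xs → letterProduct present (closedSlots xs) ω)
             (λ 1≤w → 1≤w) (shortCycleLists n′ g) ⟩
      ∑ (shortCycleLists n′ g) (λ xs → letterProduct present (closedSlots xs) ω)
        ≡⟨ ∑-concatMap (cycleLists n′) (upTo (suc g)) _ ⟩
      cycles ω
        ≤⟨ m≤n+m (cycles ω) _ ⟩
      score ω
        <⟨ lt ⟩
      K ∎

    conclude : (∃ λ ω → score ω < K) →
      ∃ λ ω → #independent n′ a ω ≡ 0 × length (shortCycles n′ g ω) < K
    conclude (ω , lt) = ω , independent≡0 ω lt , cycles<K ω lt

-- Fractional colourings

-- `natℚ` normalises by a gcd that does not reduce on variables, so its arithmetic is derived from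
-- unnormalised fractions.
natℚᵘ : ∀ m → ℚ.toℚᵘ (natℚ m) ℚᵘ.≃ ℚᵘ.mkℚᵘ (ℤ.+ m) 0
natℚᵘ m = ℚ.toℚᵘ-fromℚᵘ (ℚᵘ.mkℚᵘ (ℤ.+ m) 0)

natℚ-+ : ∀ m k → natℚ (m + k) ≡ natℚ m ℚ.+ natℚ k
natℚ-+ m k = ℚ.toℚᵘ-injective (begin
  ℚ.toℚᵘ (natℚ (m + k))                          ≈⟨ natℚᵘ (m + k) ⟩
  ℚᵘ.mkℚᵘ (ℤ.+ (m + k)) 0                        ≈⟨ ℚᵘ.*≡* (cong (ℤ._* ℤ.1ℤ)
    (sym (cong₂ ℤ._+_ (ℤ.*-identityʳ (ℤ.+ m)) (ℤ.*-identityʳ (ℤ.+ k))))) ⟩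
  ℚᵘ.mkℚᵘ (ℤ.+ m) 0 ℚᵘ.+ ℚᵘ.mkℚᵘ (ℤ.+ k) 0       ≈⟨ ℚᵘ.+-cong (natℚᵘ m) (natℚᵘ k) ⟨
  ℚ.toℚᵘ (natℚ m) ℚᵘ.+ ℚ.toℚᵘ (natℚ k)           ≈⟨ ℚ.toℚᵘ-homo-+ (natℚ m) (natℚ k) ⟨
  ℚ.toℚᵘ (natℚ m ℚ.+ natℚ k)                     ∎)
  where open import Relation.Binary.Reasoning.Setoid ℚᵘ.≃-setoid

natℚ-* : ∀ m k → natℚ (m * k) ≡ natℚ m ℚ.* natℚ k
natℚ-* m k = ℚ.toℚᵘ-injective (begin
  ℚ.toℚᵘ (natℚ (m * k))                          ≈⟨ natℚᵘ (m * k) ⟩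
  ℚᵘ.mkℚᵘ (ℤ.+ (m * k)) 0                        ≈⟨ ℚᵘ.*≡* (cong (ℤ._* ℤ.1ℤ) (ℤ.pos-* m k)) ⟩
  ℚᵘ.mkℚᵘ (ℤ.+ m) 0 ℚᵘ.* ℚᵘ.mkℚᵘ (ℤ.+ k) 0       ≈⟨ ℚᵘ.*-cong (natℚᵘ m) (natℚᵘ k) ⟨
  ℚ.toℚᵘ (natℚ m) ℚᵘ.* ℚ.toℚᵘ (natℚ k)           ≈⟨ ℚ.toℚᵘ-homo-* (natℚ m) (natℚ k) ⟨
  ℚ.toℚᵘ (natℚ m ℚ.* natℚ k)                     ∎)
  where open import Relation.Binary.Reasoning.Setoid ℚᵘ.≃-setoid

natℚ-mono-≤ : ∀ {m k} → m ≤ k → natℚ m ℚ.≤ natℚ k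
natℚ-mono-≤ {m} {k} m≤k = ℚ.toℚᵘ-cancel-≤ (begin
  ℚ.toℚᵘ (natℚ m)    ≃⟨ natℚᵘ m ⟩
  ℚᵘ.mkℚᵘ (ℤ.+ m) 0  ≤⟨ ℚᵘ.*≤* (ℤ.*-monoʳ-≤-nonNeg ℤ.1ℤ (ℤ.+≤+ m≤k)) ⟩
  ℚᵘ.mkℚᵘ (ℤ.+ k) 0  ≃⟨ natℚᵘ k ⟨
  ℚ.toℚᵘ (natℚ k)    ∎)
  where open ℚᵘ.≤-Reasoning

natℚ-mono-< : ∀ {m k} → m < k → natℚ m ℚ.< natℚ k
natℚ-mono-< {m} {k} m<k = ℚ.toℚᵘ-cancel-< (begin-strict
  ℚ.toℚᵘ (natℚ m)    ≃⟨ natℚᵘ m ⟩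
  ℚᵘ.mkℚᵘ (ℤ.+ m) 0  <⟨ ℚᵘ.*<* (ℤ.*-monoʳ-<-pos ℤ.1ℤ (ℤ.+<+ m<k)) ⟩
  ℚᵘ.mkℚᵘ (ℤ.+ k) 0  ≃⟨ natℚᵘ k ⟨
  ℚ.toℚᵘ (natℚ k)    ∎)
  where open ℚᵘ.≤-Reasoning

natℚ-cancel-< : ∀ {m k} → natℚ m ℚ.< natℚ k → m < k
natℚ-cancel-< lt = ≰⇒> (λ k≤m → ℚ.<-irrefl refl (ℚ.<-≤-trans lt (natℚ-mono-≤ k≤m)))

0≤natℚ : ∀ m → 0ℚ ℚ.≤ natℚ m
0≤natℚ m = natℚ-mono-≤ {0} {m} z≤n

sumSubsets-mono : ∀ n {f g : Subset n → ℚ} → (∀ S → f S ℚ.≤ g S) → sumSubsets n f ℚ.≤ sumSubsets n g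
sumSubsets-mono zero    f≤g = f≤g []
sumSubsets-mono (suc n) f≤g = ℚ.+-mono-≤
  (sumSubsets-mono n (f≤g ∘ (outside ∷_))) (sumSubsets-mono n (f≤g ∘ (inside ∷_)))

sumSubsets-+ : ∀ n (f g : Subset n → ℚ) →
  sumSubsets n (λ S → f S ℚ.+ g S) ≡ sumSubsets n f ℚ.+ sumSubsets n g
sumSubsets-+ zero    f g = refl
sumSubsets-+ (suc n) f g =
  trans (cong₂ ℚ._+_ (sumSubsets-+ n (f ∘ (outside ∷_)) (g ∘ (outside ∷_)))
                     (sumSubsets-+ n (f ∘ (inside ∷_)) (g ∘ (inside ∷_))))
        (interchange (sumSubsets n (f ∘ (outside ∷_))) (sumSubsets n (g ∘ (outside ∷_)))
                     (sumSubsets n (f ∘ (inside ∷_))) (sumSubsets n (g ∘ (inside ∷_))))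
  where
  open import Algebra.Properties.CommutativeSemigroup
    (CommutativeMonoid.commutativeSemigroup ℚ.+-0-commutativeMonoid) using (interchange)

sumSubsets-* : ∀ n q (f : Subset n → ℚ) → sumSubsets n (λ S → q ℚ.* f S) ≡ q ℚ.* sumSubsets n f
sumSubsets-* zero    q f = refl
sumSubsets-* (suc n) q f =
  trans (cong₂ ℚ._+_ (sumSubsets-* n q _) (sumSubsets-* n q _)) (sym (ℚ.*-distribˡ-+ q _ _))


-- Double counting of the pairs (v , S) with v ∈ vs and v ∈ S, weighted by a colouring.
covers-list : ∀ {G} (C : FractionalColouring G) (vs : List (Vertex G)) → natℚ (length vs) ℚ.≤
  sumSubsets (order G) (λ S → natℚ (length (filter (_∈? S) vs)) ℚ.* FractionalColouring.weight C S)
covers-list {G} C []       = ℚ.≤-reflexive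
  (sym (trans (sumSubsets-* (order G) 0ℚ weight) (ℚ.*-zeroˡ (sumSubsets (order G) weight))))
  where open FractionalColouring C
covers-list {G} C (v ∷ vs) = begin
  natℚ (1 + length vs)
    ≡⟨ natℚ-+ 1 (length vs) ⟩
  1ℚ ℚ.+ natℚ (length vs)
    ≤⟨ ℚ.+-mono-≤ (covers v) (covers-list C vs) ⟩
  sumSubsets (order G) (λ S → if does (v ∈? S) then weight S else 0ℚ) ℚ.+
    sumSubsets (order G) (λ S → natℚ (length (filter (_∈? S) vs)) ℚ.* weight S)
    ≡⟨ sumSubsets-+ (order G) _ _ ⟨
  sumSubsets (order G) (λ S → (if does (v ∈? S) then weight S else 0ℚ) ℚ.+
    natℚ (length (filter (_∈? S) vs)) ℚ.* weight S)
    ≤⟨ sumSubsets-mono (order G) (ℚ.≤-reflexive ∘ pointwise) ⟩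
  sumSubsets (order G) (λ S → natℚ (length (filter (_∈? S) (v ∷ vs))) ℚ.* weight S) ∎
  where
  open FractionalColouring C
  open ℚ.≤-Reasoning
  pointwise : ∀ S → (if does (v ∈? S) then weight S else 0ℚ) ℚ.+
    natℚ (length (filter (_∈? S) vs)) ℚ.* weight S ≡
    natℚ (length (filter (_∈? S) (v ∷ vs))) ℚ.* weight S
  pointwise S with does (v ∈? S)
  ... | false = ℚ.+-identityˡ _
  ... | true  = sym (trans (cong (ℚ._* weight S) (natℚ-+ 1 k))
                  (trans (ℚ.*-distribʳ-+ (weight S) 1ℚ (natℚ k))
                    (cong (ℚ._+ natℚ k ℚ.* weight S) (ℚ.*-identityˡ (weight S)))))
    where k = length (filter (_∈? S) vs)

-- Weak linear programming duality with dual weight 1 / a on the entries of `vs`, multiplied through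
-- by `a`. Sets meeting `vs` more than `a` times carry weight zero because they are not independent.
length≤a*total : ∀ {G} a (vs : List (Vertex G)) →
  (∀ S → a < length (filter (_∈? S) vs) → ¬ Independent G S) →
  (C : FractionalColouring G) → natℚ (length vs) ℚ.≤ natℚ a ℚ.* FractionalColouring.total C
length≤a*total {G} a vs dependent C = begin
  natℚ (length vs)
    ≤⟨ covers-list C vs ⟩
  sumSubsets (order G) (λ S → natℚ (length (filter (_∈? S) vs)) ℚ.* weight S)
    ≤⟨ sumSubsets-mono (order G) pointwise ⟩
  sumSubsets (order G) (λ S → natℚ a ℚ.* weight S)
    ≡⟨ sumSubsets-* (order G) (natℚ a) weight ⟩
  natℚ a ℚ.* total ∎
  where
  open FractionalColouring C
  open ℚ.≤-Reasoning
  pointwise : ∀ S → natℚ (length (filter (_∈? S) vs)) ℚ.* weight S ℚ.≤ natℚ a ℚ.* weight S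
  pointwise S with length (filter (_∈? S) vs) ≤? a
  ... | yes k≤a = ℚ.*-monoʳ-≤-nonNeg (weight S) {{ℚ.nonNegative (nonneg S)}} (natℚ-mono-≤ k≤a)
  ... | no  k≰a rewrite independent S (dependent S (≰⇒> k≰a)) =
    ℚ.≤-reflexive (trans (ℚ.*-zeroʳ (natℚ (length (filter (_∈? S) vs)))) (sym (ℚ.*-zeroʳ (natℚ a))))


-- Pruning a graph at its short cycles

Unique-⊆⇒length≤ : ∀ {xs ys : List X} → Unique xs → xs ⊆ ys → length xs ≤ length ys
Unique-⊆⇒length≤ []                          _     = z≤n
Unique-⊆⇒length≤ {xs = x ∷ xs} {ys} (x∉ ∷ xs!) xs⊆ys with ∈.∈-∃++ (xs⊆ys (here refl))
... | as , bs , refl = begin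
  suc (length xs)              ≤⟨ s≤s (Unique-⊆⇒length≤ xs! xs⊆as++bs) ⟩
  suc (length (as ++ bs))      ≡⟨ cong suc (List.length-++ as) ⟩
  suc (length as + length bs)  ≡⟨ +-suc (length as) (length bs) ⟨
  length as + suc (length bs)  ≡⟨ List.length-++ as ⟨
  length (as ++ x ∷ bs)        ∎
  where
  open ≤-Reasoning
  xs⊆as++bs : xs ⊆ as ++ bs
  xs⊆as++bs {y} y∈ with ∈.∈-++⁻ as (xs⊆ys (there y∈))
  ... | inj₁ y∈as         = ∈.∈-++⁺ˡ y∈as
  ... | inj₂ (here refl)  = contradiction refl (All.lookup x∉ y∈)
  ... | inj₂ (there y∈bs) = ∈.∈-++⁺ʳ as y∈bs

letterProduct≡1 : ∀ {N} (f : X → ℕ) (ω : Vec X N) {L : List (Fin N)} →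
  All (λ s → f (lookup ω s) ≡ 1) L → letterProduct f L ω ≡ 1
letterProduct≡1 f ω []       = refl
letterProduct≡1 f ω (p ∷ ps) = cong₂ _*_ p (letterProduct≡1 f ω ps)

pathSlots-tabulate : ∀ {P : Fin (n * n) → Set} m (f : Fin (suc m) → Fin n) z →
  (∀ i → P (slot (f (inject₁ i)) (f (suc i)))) → P (slot (f (fromℕ m)) z) →
  All P (pathSlots (f zero) (tabulate (f ∘ suc)) z)
pathSlots-tabulate zero    f z edge last = last ∷ []
pathSlots-tabulate (suc m) f z edge last =
  edge zero ∷ pathSlots-tabulate m (f ∘ suc) z (edge ∘ suc) last

module Pruned {n : ℕ} (g : ℕ) (ω : Vec Bool (n * n)) where

  open DecMembership (Fin._≟_ {n}) using () renaming (_∈?_ to _∈ˡ?_)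

  bad good : List (Fin n)
  bad  = mapMaybe head (shortCycles n g ω)
  good = filter (λ v → ¬? (v ∈ˡ? bad)) (allFin n)

  -- The diagonal letters are random too, hence the condition `u ≢ v`.
  Edge : Fin n → Fin n → Set
  Edge u v = u ≢ v × u ∉ bad × v ∉ bad × T (lookup ω (slot u v))

  edge? : ∀ u v → Dec (Edge u v)
  edge? u v = ¬? (u Fin.≟ v) ×-dec ¬? (u ∈ˡ? bad) ×-dec ¬? (v ∈ˡ? bad) ×-dec T? (lookup ω (slot u v))

  graph : Graph
  graph .order = n
  graph .adj u v = ⌊ edge? u v ⌋
  graph .adj-sym {u} {v} t with toWitness {a? = edge? u v} t
  ... | u≢v , u∉ , v∉ , e =
    fromWitness {a? = edge? v u} (u≢v ∘ sym , v∉ , u∉ , subst (T ∘ lookup ω) (slot-sym u v) e)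
  graph .adj-irrefl {u} t = proj₁ (toWitness {a? = edge? u u} t) refl

  n≤good+bad : n ≤ length good + length (shortCycles n g ω)
  n≤good+bad = begin
    n                                          ≡⟨ List.length-tabulate {n = n} (λ i → i) ⟨
    length (allFin n)                          ≤⟨ Unique-⊆⇒length≤ (Unique.allFin⁺ n) split ⟩
    length (good ++ bad)                       ≡⟨ List.length-++ good ⟩
    length good + length bad                   ≤⟨ +-monoʳ-≤ (length good)
                                                    (List.length-mapMaybe head (shortCycles n g ω)) ⟩
    length good + length (shortCycles n g ω)   ∎
    where
    open ≤-Reasoning
    split : allFin n ⊆ good ++ bad
    split {v} v∈ with v ∈ˡ? bad
    ... | yes v∈bad = ∈.∈-++⁺ʳ good v∈bad
    ... | no  v∉bad = ∈.∈-++⁺ˡ (∈.∈-filter⁺ (λ v → ¬? (v ∈ˡ? bad)) v∈ v∉bad)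

  -- A cycle of length at most `g` is itself one of the listed short cycles, so its starting vertex
  -- is bad, yet that vertex has an edge. Every rotation is listed separately, so no choice of a
  -- representative arises; the count of short cycles includes all of them.
  girth : Girth≥ graph (suc g)
  girth {m} C with suc m ≤? g
  ... | no  m≮g = ≰⇒> m≮g
  ... | yes m<g = contradiction vertex-zero∈bad (proj₁ (proj₂ (proj₂ closingEdge)))
    where
    open CycleOn C
    closingEdge = toWitness {a? = edge? (vertex (fromℕ m)) (vertex zero)} closing

    xs : List (Fin n)
    xs = tabulate vertex

    length-xs : length xs ≡ suc m
    length-xs = List.length-tabulate vertex

    present≡1 : ∀ {u v} → Edge u v → present (lookup ω (slot u v)) ≡ 1
    present≡1 {u} {v} (_ , _ , _ , e) = cong present (Equivalence.to T-≡ e)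

    xs-closed : Closed n ω xs
    xs-closed = ≤-reflexive (sym (letterProduct≡1 present ω (pathSlots-tabulate m vertex (vertex zero)
      (λ i → present≡1 (toWitness {a? = edge? (vertex (inject₁ i)) (vertex (suc i))} (edge i)))
      (present≡1 closingEdge))))

    isCycleList : IsCycleList xs
    isCycleList = ≤-trans 3≤length (≤-reflexive (sym length-xs)) , Unique.tabulate⁺ distinct

    xs∈shortCycles : xs ∈ shortCycles n g ω
    xs∈shortCycles = ∈.∈-filter⁺ (closed? n ω)
      (∈.∈-concatMap⁺ (cycleLists n) (lose (∈.∈-upTo⁺ (s≤s m<g))
        (∈.∈-filter⁺ isCycleList? (subst (λ k → xs ∈ lists n k) length-xs (∈-lists⁺ xs)) isCycleList)))
      xs-closed

    vertex-zero∈bad : vertex zero ∈ bad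
    vertex-zero∈bad = Any.mapMaybe⁺ head (shortCycles n g ω) (Any.map⁺ (lose xs∈shortCycles (Maybe.just refl)))

  -- Between good vertices no edge was deleted, so `a` good vertices of an independent set would
  -- form one of the lists counted by `#independent`.
  dependent : ∀ a → #independent n a ω ≡ 0 →
    ∀ S → a ≤ length (filter (_∈? S) good) → ¬ Independent graph S
  dependent a none S a≤ S-independent = contradiction (trans (sym product-xs≡1) product-xs≡0) λ ()
    where
    members xs : List (Fin n)
    members = filter (_∈? S) good
    xs = take a members

    xs! : Unique xs
    xs! = Unique.take⁺ a (Unique.filter⁺ (_∈? S) (Unique.filter⁺ (λ v → ¬? (v ∈ˡ? bad)) (Unique.allFin⁺ n)))

    length-xs : length xs ≡ a
    length-xs = trans (List.length-take a members) (m≤n⇒m⊓n≡m a≤)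

    product-xs≡0 : letterProduct absent (pairSlots xs) ω ≡ 0
    product-xs≡0 = ∑≡0⇒≡0 (distinctLists n a) _ none
      (∈.∈-filter⁺ (unique? Fin._≟_) (subst (λ k → xs ∈ lists n k) length-xs (∈-lists⁺ xs)) xs!)

    ∈members⇒ : ∀ {v} → v ∈ members → v Subset.∈ S × v ∉ bad
    ∈members⇒ v∈ with ∈.∈-filter⁻ (_∈? S) {xs = good} v∈
    ... | v∈good , v∈S = v∈S , proj₂ (∈.∈-filter⁻ (λ v → ¬? (v ∈ˡ? bad)) {xs = allFin n} v∈good)

    ∈xs⇒ : ∀ {v} → v ∈ xs → v Subset.∈ S × v ∉ bad
    ∈xs⇒ = All.lookup (All.take⁺ a (All.tabulate ∈members⇒))


    absent≡1 : ∀ {s} → s ∈ pairSlots xs → absent (lookup ω s) ≡ 1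
    absent≡1 s∈ with ∈-pairSlots⁻ xs xs! s∈
    ... | u , v , u∈ , v∈ , u≢v , refl with lookup ω (slot u v) in eq
    ...   | false = refl
    ...   | true  = contradiction (fromWitness {a? = edge? u v}
            (u≢v , proj₂ (∈xs⇒ u∈) , proj₂ (∈xs⇒ v∈) , Equivalence.from T-≡ eq))
            (S-independent (proj₁ (∈xs⇒ u∈)) (proj₁ (∈xs⇒ v∈)))

    product-xs≡1 : letterProduct absent (pairSlots xs) ω ≡ 1
    product-xs≡1 = letterProduct≡1 absent ω (All.tabulate absent≡1)

  length-good≤a*total : ∀ a → #independent n (suc a) ω ≡ 0 →
    (C : FractionalColouring graph) → natℚ (length good) ℚ.≤ natℚ a ℚ.* FractionalColouring.total C
  length-good≤a*total a none = length≤a*total a good (dependent (suc a) none)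

-- Numerical estimates

^-distribʳ-* : ∀ m n k → (m * n) ^ k ≡ m ^ k * n ^ k
^-distribʳ-* m n zero    = refl
^-distribʳ-* m n (suc k) = trans (cong (m * n *_) (^-distribʳ-* m n k)) (shuffle m n (m ^ k) (n ^ k))
  where
  shuffle : ∀ a b x y → a * b * (x * y) ≡ a * x * (b * y)
  shuffle = solve-∀

^-cancelˡ-≤ : ∀ k .{{_ : NonZero k}} {m n} → m ^ k ≤ n ^ k → m ≤ n
^-cancelˡ-≤ k m^k≤n^k = ≮⇒≥ (λ n<m → <⇒≱ (^-monoˡ-< k n<m) m^k≤n^k)

^-swap : ∀ m k l → (m ^ k) ^ l ≡ (m ^ l) ^ k
^-swap m k l = trans (^-*-assoc m k l) (trans (cong (m ^_) (*-comm k l)) (sym (^-*-assoc m l k)))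

n<2^n : ∀ n → n < 2 ^ n
n<2^n zero    = s≤s z≤n
n<2^n (suc n) = begin
  2 + n            ≤⟨ +-mono-≤ (m^n>0 2 n) (n<2^n n) ⟩
  2 ^ n + 2 ^ n    ≡⟨ cong (2 ^ n +_) (+-identityʳ (2 ^ n)) ⟨
  2 ^ suc n        ∎
  where open ≤-Reasoning

m≤[1+m/n]*n : ∀ m n .{{_ : NonZero n}} → m ≤ suc (m / n) * n
m≤[1+m/n]*n m n = ≤-trans (≤-reflexive (m≡m%n+[m/n]*n m n)) (+-monoˡ-≤ (m / n * n) (<⇒≤ (m%n<n m n)))

-- Writing L ≤ (q + 1) (M + 1) with q = ⌊ L / (M + 1) ⌋, the inequality q + 1 ≤ 2 ^ q raised to the
-- power M + 1 gains one factor L over L ^ M.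
polynomial≤exponential : ∀ M C L → C * suc M ^ suc M ≤ L → C * L ^ M ≤ 2 ^ L
polynomial≤exponential M C L large = *-cancelʳ-≤ (C * L ^ M) (2 ^ L) D {{m^n≢0 (suc M) (suc M)}} (begin
  C * L ^ M * D              ≡⟨ shuffle C (L ^ M) D ⟩
  C * D * L ^ M              ≤⟨ *-monoˡ-≤ (L ^ M) large ⟩
  L ^ suc M                  ≤⟨ ^-monoˡ-≤ (suc M) (m≤[1+m/n]*n L (suc M)) ⟩
  (suc q * suc M) ^ suc M    ≡⟨ ^-distribʳ-* (suc q) (suc M) (suc M) ⟩
  suc q ^ suc M * D          ≤⟨ *-monoˡ-≤ D (^-monoˡ-≤ (suc M) (n<2^n q)) ⟩
  (2 ^ q) ^ suc M * D        ≡⟨ cong (_* D) (^-*-assoc 2 q (suc M)) ⟩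
  2 ^ (q * suc M) * D        ≤⟨ *-monoˡ-≤ D (^-monoʳ-≤ 2 (m/n*n≤m L (suc M))) ⟩
  2 ^ L * D                  ∎)
  where
  open ≤-Reasoning
  D = suc M ^ suc M
  q = L / suc M
  shuffle : ∀ x y z → x * y * z ≡ x * z * y
  shuffle = solve-∀

binaryLength : ∀ n → ∃ λ l → 2 ^ l ≤ suc n × suc n < 2 ^ suc l
binaryLength zero    = 0 , s≤s z≤n , s≤s (s≤s z≤n)
binaryLength (suc n) with binaryLength n
... | l , 2^l≤ , <2^ with suc (suc n) <? 2 ^ suc l
...   | yes lt = l , ≤-trans 2^l≤ (n≤1+n (suc n)) , lt
...   | no  ge = suc l , ≮⇒≥ ge , ≤-<-trans <2^ (^-monoʳ-< 2 (s≤s (s≤s z≤n)) (n<1+n (suc l)))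

-- Bernoulli's inequality for (1 + d / c) ^ h, cleared of denominators.
bernoulli : ∀ c d h → c ^ h * (c + h * d) ≤ c * (d + c) ^ h
bernoulli c d zero    = ≤-reflexive (trans (+-identityʳ _) (trans (+-identityʳ c) (sym (*-identityʳ c))))
bernoulli c d (suc h) = begin
  c ^ suc h * (c + suc h * d)              ≤⟨ m≤m+n _ (c ^ h * (h * d * d)) ⟩
  c ^ suc h * (c + suc h * d) + c ^ h * (h * d * d)
                                           ≡⟨ factor c d h (c ^ h) ⟩
  c ^ h * (c + h * d) * (d + c)            ≤⟨ *-monoˡ-≤ (d + c) (bernoulli c d h) ⟩
  c * (d + c) ^ h * (d + c)                ≡⟨ shuffle c ((d + c) ^ h) (d + c) ⟩
  c * (d + c) ^ suc h                      ∎
  where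
  open ≤-Reasoning
  factor : ∀ c d h x → c * x * (c + (d + h * d)) + x * (h * d * d) ≡ x * (c + h * d) * (d + c)
  factor = solve-∀
  shuffle : ∀ x y z → x * y * z ≡ x * (z * y)
  shuffle = solve-∀

-- With p = d / (d + c), this is (1 - p) ^ (h + 1) ≤ 1/2 as soon as (h + 1) p ≥ 1, an elementary
-- substitute for 1 - p ≤ exp (- p). Bernoulli's inequality needs `c` positive for the final
-- cancellation.
halving : ∀ c d h → d + c ≤ suc h * d → 2 * c ^ suc h ≤ (d + c) ^ suc h
halving zero    d h _  = z≤n
halving (suc c) d h le = *-cancelˡ-≤ (suc c) (begin
  suc c * (2 * suc c ^ suc h)              ≡⟨ shuffle (suc c) (suc c ^ suc h) ⟩
  suc c ^ suc h * (suc c + suc c)          ≤⟨ *-monoʳ-≤ (suc c ^ suc h)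
                                                (+-monoʳ-≤ (suc c) (≤-trans (m≤n+m (suc c) d) le)) ⟩
  suc c ^ suc h * (suc c + suc h * d)      ≤⟨ bernoulli (suc c) d (suc h) ⟩
  suc c * (d + suc c) ^ suc h              ∎)
  where
  open ≤-Reasoning
  shuffle : ∀ x y → x * (2 * y) ≡ y * (x + x)
  shuffle = solve-∀

-- Taking `halving` to the power `L` gives (1 - p) ^ e ≤ 2 ^ (- L) ≤ 1 / (2 n). Each of the a + 1
-- vertices thus pays for its n choices and saves a further factor 2, of which one is kept.
few-independent : ∀ c d h L a → d + c ≤ suc h * d → 2 * (d + c) ≤ 2 ^ L →
  2 * ((d + c) ^ suc a * c ^ (suc h * L * suc a)) ≤ (d + c) ^ (suc h * L * suc a)
few-independent c d h L a n≤hd 2n≤2^L = begin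
  2 * (n′ ^ suc a * c ^ (e * suc a))
    ≤⟨ *-monoˡ-≤ (n′ ^ suc a * c ^ (e * suc a)) (*-monoʳ-≤ 2 (m^n>0 2 a)) ⟩
  2 ^ suc a * (n′ ^ suc a * c ^ (e * suc a))
    ≡⟨ *-assoc (2 ^ suc a) _ _ ⟨
  2 ^ suc a * n′ ^ suc a * c ^ (e * suc a)
    ≡⟨ cong₂ _*_ (sym (^-distribʳ-* 2 n′ (suc a))) (sym (^-*-assoc c e (suc a))) ⟩
  (2 * n′) ^ suc a * (c ^ e) ^ suc a
    ≡⟨ ^-distribʳ-* (2 * n′) (c ^ e) (suc a) ⟨
  (2 * n′ * c ^ e) ^ suc a
    ≤⟨ ^-monoˡ-≤ (suc a) one-vertex ⟩
  (n′ ^ e) ^ suc a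
    ≡⟨ ^-*-assoc n′ e (suc a) ⟩
  n′ ^ (e * suc a) ∎
  where
  open ≤-Reasoning
  n′ = d + c
  e = suc h * L
  one-vertex : 2 * n′ * c ^ e ≤ n′ ^ e
  one-vertex = begin
    2 * n′ * c ^ e              ≤⟨ *-monoˡ-≤ (c ^ e) 2n≤2^L ⟩
    2 ^ L * c ^ e              ≡⟨ cong (2 ^ L *_) (^-*-assoc c (suc h) L) ⟨
    2 ^ L * (c ^ suc h) ^ L    ≡⟨ ^-distribʳ-* 2 (c ^ suc h) L ⟨
    (2 * c ^ suc h) ^ L        ≤⟨ ^-monoˡ-≤ L (halving c d h n≤hd) ⟩
    (n′ ^ suc h) ^ L            ≡⟨ ^-*-assoc n′ (suc h) L ⟩
    n′ ^ e                      ∎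

-- Graphs of large girth and large fractional chromatic number

GraphWith : (n r t : ℕ) → Set
GraphWith n r t = ∃ λ G → order G ≡ n × Girth≥ G r ×
  (∀ (C : FractionalColouring G) → natℚ t ℚ.≤ FractionalColouring.total C)

-- The random graph of average degree d = 8 t L has independent sets of at most a vertices, where
-- a = 2 (⌊ n / d ⌋ + 1) L is about n / (4 t).
sparse⇒graph : ∀ n g t L .{{_ : NonZero g}} .{{_ : NonZero t}} .{{_ : NonZero L}} → 2 * n ≤ 2 ^ L →
  (4 * suc g + 2) * (8 * t * L) ^ g ≤ n → GraphWith n (suc g) t
sparse⇒graph n g@(suc g-1) t L 2n≤2^L sparse =
  subst (λ n → GraphWith n (suc g) t) d+c≡n
    (graph , refl , girth , total≥t)
  where
  d c h e a K : ℕ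
  d = 8 * t * L
  instance
    d≢0 : NonZero d
    d≢0 = m*n≢0 (8 * t) L {{m*n≢0 8 t}}
  c = n ∸ d
  h = n / d
  e = suc h * L
  a = 2 * e
  K = suc (2 * (suc g * d ^ g))

  d≤n : d ≤ n
  d≤n = begin
    d                          ≡⟨ *-identityʳ d ⟨
    d * 1                      ≤⟨ *-monoʳ-≤ d (m^n>0 d g-1) ⟩
    d ^ g                      ≤⟨ m≤n*m (d ^ g) (4 * suc g + 2) ⟩
    (4 * suc g + 2) * d ^ g    ≤⟨ sparse ⟩
    n                          ∎
    where open ≤-Reasoning

  d+c≡n : d + c ≡ n
  d+c≡n = m+[n∸m]≡n d≤n

  -- Origin of the factor `4 * suc g + 2`: the deleted vertices, fewer than `K`, must be at most
  -- half of all.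
  2K≤n : 2 * K ≤ n
  2K≤n = begin
    2 * K                              ≡⟨ expand (suc g) (d ^ g) ⟩
    4 * suc g * d ^ g + 2 * 1          ≤⟨ +-monoʳ-≤ (4 * suc g * d ^ g) (*-monoʳ-≤ 2 (m^n>0 d g)) ⟩
    4 * suc g * d ^ g + 2 * d ^ g      ≡⟨ *-distribʳ-+ (d ^ g) (4 * suc g) 2 ⟨
    (4 * suc g + 2) * d ^ g            ≤⟨ sparse ⟩
    n                                  ∎
    where
    open ≤-Reasoning
    expand : ∀ g x → 2 * suc (2 * (g * x)) ≡ 4 * g * x + 2 * 1
    expand = solve-∀

  -- The choice a = 2 e makes e (a + 1) exactly the number of pairs among a + 1 vertices.
  moment = firstMoment d c g (suc a) (e * suc a) K (square e)
    (few-independent c d h L a (≤-trans (≤-reflexive d+c≡n) (m≤[1+m/n]*n n d))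
      (≤-trans (≤-reflexive (cong (2 *_) d+c≡n)) 2n≤2^L))
    (n<1+n _)
    where
    square : ∀ e → 2 * (e * suc (2 * e)) + suc (2 * e) ≡ suc (2 * e) * suc (2 * e)
    square = solve-∀

  open Pruned {d + c} g (proj₁ moment)

  -- Origin of the 8 in `d`: 4 t a = (h + 1) d ≤ 2 n, while at least n / 2 vertices are good.
  t*a≤good : t * a ≤ length good
  t*a≤good = *-cancelˡ-≤ 4 (begin
    4 * (t * a)                      ≡⟨ regroup t L h ⟩
    8 * t * L + h * (8 * t * L)      ≤⟨ +-mono-≤ d≤n (m/n*n≤m n d) ⟩
    n + n                            ≡⟨ cong (n +_) (+-identityʳ n) ⟨
    2 * n                            ≤⟨ *-monoʳ-≤ 2 n≤2good ⟩
    2 * (2 * length good)            ≡⟨ *-assoc 2 2 (length good) ⟨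
    4 * length good                  ∎)
    where
    open ≤-Reasoning
    regroup : ∀ t L h → 4 * (t * (2 * (suc h * L))) ≡ 8 * t * L + h * (8 * t * L)
    regroup = solve-∀
    double : ∀ x → x + x ≡ 2 * x
    double = solve-∀
    n≤2good : n ≤ 2 * length good
    n≤2good = +-cancelʳ-≤ n _ _ (begin
      n + n                          ≡⟨ double n ⟩
      2 * n                          ≤⟨ *-monoʳ-≤ 2 (≤-trans (≤-reflexive (sym d+c≡n))
                                          (≤-trans n≤good+bad
                                            (+-monoʳ-≤ (length good) (<⇒≤ (proj₂ (proj₂ moment)))))) ⟩
      2 * (length good + K)          ≡⟨ *-distribˡ-+ 2 (length good) K ⟩
      2 * length good + 2 * K        ≤⟨ +-monoʳ-≤ (2 * length good) 2K≤n ⟩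
      2 * length good + n            ∎)

  total≥t : (C : FractionalColouring graph) → natℚ t ℚ.≤ FractionalColouring.total C
  total≥t C = ℚ.*-cancelˡ-≤-pos (natℚ a) {{ℚ.positive (natℚ-mono-< 0<a)}} (begin
    natℚ a ℚ.* natℚ t                      ≡⟨ natℚ-* a t ⟨
    natℚ (a * t)                           ≡⟨ cong natℚ (*-comm a t) ⟩
    natℚ (t * a)                           ≤⟨ natℚ-mono-≤ t*a≤good ⟩
    natℚ (length good)                     ≤⟨ length-good≤a*total a (proj₁ (proj₂ moment)) C ⟩
    natℚ a ℚ.* FractionalColouring.total C ∎)
    where
    open ℚ.≤-Reasoning
    0<a : 0 < a
    0<a = >-nonZero⁻¹ a {{m*n≢0 2 e {{_}} {{m*n≢0 (suc h) L}}}}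

-- Erdős's theorem: t can be any power n ^ (A / B) with A / B < 1 / g, up to the constant D.
largeGirthGraph : ∀ g A B D .{{_ : NonZero g}} → A * g < B → ∃ λ n₀ → ∀ n → n₀ ≤ n →
  ∀ t .{{_ : NonZero t}} → t ^ B ≤ D * n ^ A → GraphWith n (suc g) t
largeGirthGraph g A B D Ag<B = 2 ^ L₀ , construct
  where
  W C M L₀ : ℕ
  W = 4 * suc g + 2
  M = g * B
  C = W ^ B * 8 ^ M * D ^ g
  -- The threshold of `polynomial≤exponential` for the constant 4 C; the 4 offsets 2 ^ L = 4 * 2 ^ l
  -- ≤ 4 n below.
  L₀ = 4 * C * suc M ^ suc M

  construct : ∀ n → 2 ^ L₀ ≤ n → ∀ t .{{_ : NonZero t}} → t ^ B ≤ D * n ^ A → GraphWith n (suc g) t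
  construct zero      large t t^B≤ = contradiction large (<⇒≱ (m^n>0 2 L₀))
  construct n@(suc n-1) large t t^B≤ with binaryLength n-1
  ... | l , 2^l≤n , n<2^1+l = sparse⇒graph n g t L
          (*-monoʳ-≤ 2 (<⇒≤ n<2^1+l)) (^-cancelˡ-≤ B {{>-nonZero (≤-<-trans z≤n Ag<B)}} sparse^B)
    where
    open ≤-Reasoning
    L : ℕ
    -- One unit rounds `n` up to a power of 2, the other provides the factor 2 in 2 n ≤ 2 ^ L.
    L = 2 + l

    L₀≤L : L₀ ≤ L
    L₀≤L = ≮⇒≥ λ L<L₀ → <⇒≱ n<2^1+l (begin
      2 ^ suc l  ≤⟨ ^-monoʳ-≤ 2 (≤-trans (n≤1+n (suc l)) (<⇒≤ L<L₀)) ⟩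
      2 ^ L₀     ≤⟨ large ⟩
      n          ∎)

    C*L^M≤n : C * L ^ M ≤ n
    C*L^M≤n = *-cancelˡ-≤ 4 (begin
      4 * (C * L ^ M)  ≡⟨ *-assoc 4 C (L ^ M) ⟨
      4 * C * L ^ M    ≤⟨ polynomial≤exponential M (4 * C) L L₀≤L ⟩
      2 ^ L            ≡⟨ *-assoc 2 2 (2 ^ l) ⟨
      4 * 2 ^ l        ≤⟨ *-monoʳ-≤ 4 2^l≤n ⟩
      4 * n            ∎)

    t^M≤ : t ^ M ≤ D ^ g * n ^ (A * g)
    t^M≤ = begin
      t ^ (g * B)            ≡⟨ cong (t ^_) (*-comm g B) ⟩
      t ^ (B * g)            ≡⟨ ^-*-assoc t B g ⟨
      (t ^ B) ^ g            ≤⟨ ^-monoˡ-≤ g t^B≤ ⟩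
      (D * n ^ A) ^ g        ≡⟨ ^-distribʳ-* D (n ^ A) g ⟩
      D ^ g * (n ^ A) ^ g    ≡⟨ cong (D ^ g *_) (^-*-assoc n A g) ⟩
      D ^ g * n ^ (A * g)    ∎

    -- Only t ^ B is controlled, so the sparsity condition is proved for B-th powers. After n ^ (A
    -- g) is split off, the gap A g + 1 ≤ B leaves a factor n for C L ^ M.
    sparse^B : (W * (8 * t * L) ^ g) ^ B ≤ n ^ B
    sparse^B = begin
      (W * (8 * t * L) ^ g) ^ B
        ≡⟨ ^-distribʳ-* W ((8 * t * L) ^ g) B ⟩
      W ^ B * ((8 * t * L) ^ g) ^ B
        ≡⟨ cong (W ^ B *_) (trans (^-*-assoc (8 * t * L) g B)
             (trans (^-distribʳ-* (8 * t) L M) (cong (_* L ^ M) (^-distribʳ-* 8 t M)))) ⟩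
      W ^ B * (8 ^ M * t ^ M * L ^ M)
        ≤⟨ *-monoʳ-≤ (W ^ B) (*-monoˡ-≤ (L ^ M) (*-monoʳ-≤ (8 ^ M) t^M≤)) ⟩
      W ^ B * (8 ^ M * (D ^ g * n ^ (A * g)) * L ^ M)
        ≡⟨ regroup (W ^ B) (8 ^ M) (D ^ g) (n ^ (A * g)) (L ^ M) ⟩
      C * L ^ M * n ^ (A * g)
        ≤⟨ *-monoˡ-≤ (n ^ (A * g)) C*L^M≤n ⟩
      n ^ suc (A * g)
        ≤⟨ ^-monoʳ-≤ n Ag<B ⟩
      n ^ B ∎
      where
      regroup : ∀ w e d x y → w * (e * (d * x) * y) ≡ w * e * d * y * x
      regroup = solve-∀

-- Cliques in the line graph

record Enumeration {n} (k : ℕ) (P : Fin n → Set) : Set where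
  field
    element   : Fin k → Fin n
    injective : Injective _≡_ _≡_ element
    satisfies : ∀ i → P (element i)

enumerate : ∀ {n} (S : Subset n) → Enumeration ∣ S ∣ (Subset._∈ S)
enumerate []            = record { element = λ (); injective = λ { {()} }; satisfies = λ () }
enumerate (outside ∷ S) = record
  { element   = suc ∘ element
  ; injective = injective ∘ Fin.suc-injective
  ; satisfies = Vec.there ∘ satisfies
  }
  where open Enumeration (enumerate S)
enumerate (inside ∷ S)  = record
  { element   = element′
  ; injective = injective′
  ; satisfies = λ { zero → Vec.here; (suc i) → Vec.there (satisfies i) }
  }
  where
  open Enumeration (enumerate S)
  element′ : Fin (suc ∣ S ∣) → Fin _
  element′ zero    = zero
  element′ (suc i) = suc (element i)
  injective′ : Injective _≡_ _≡_ element′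
  injective′ {zero}  {zero}  _  = refl
  injective′ {suc i} {suc j} eq = cong suc (injective (Fin.suc-injective eq))

enumerate-tabulate : ∀ {n} (f : Fin n → Bool) →
  Enumeration ∣ Vec.tabulate f ∣ (T ∘ f)
enumerate-tabulate f = record
  { element   = element
  ; injective = injective
  ; satisfies = λ i → Equivalence.from T-≡
      (trans (sym (Vec.lookup∘tabulate f (element i))) (Vec.[]=⇒lookup (satisfies i)))
  }
  where open Enumeration (enumerate (Vec.tabulate f))

relocate : ∀ {m n k} {P : Fin m → Set} {Q : Fin n → Set} (f : Fin m → Fin n) →
  Injective _≡_ _≡_ f → (∀ {i} → P i → Q (f i)) → Enumeration k P → Enumeration k Q
relocate f f-injective P⇒Q E = record
  { element   = f ∘ element
  ; injective = injective ∘ f-injective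
  ; satisfies = P⇒Q ∘ satisfies
  }
  where open Enumeration E

neighbours : ∀ 𝒢 {s} → HasOrder 𝒢 s → (u : Vertex (incidenceGraph 𝒢)) →
  Enumeration (suc s) (Adj (incidenceGraph 𝒢) u)
neighbours 𝒢 (line-size , point-size) u with splitAt (#points 𝒢) u
... | inj₁ p = relocate (#points 𝒢 ↑ʳ_) (Fin.↑ʳ-injective (#points 𝒢) _ _)
    (λ {l} → subst (T ∘ flag 𝒢 (inj₁ p)) (sym (Fin.splitAt-↑ʳ (#points 𝒢) (#lines 𝒢) l)))
    (subst (λ k → Enumeration k (T ∘ incident 𝒢 p)) (point-size p) (enumerate-tabulate (incident 𝒢 p)))
... | inj₂ l = relocate (_↑ˡ #lines 𝒢) (Fin.↑ˡ-injective (#lines 𝒢) _ _)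
    (λ {p} → subst (T ∘ flag 𝒢 (inj₂ l)) (sym (Fin.splitAt-↑ˡ (#points 𝒢) p (#lines 𝒢))))
    (subst (λ k → Enumeration k (λ p → T (incident 𝒢 p l))) (line-size l)
      (enumerate-tabulate (λ p → incident 𝒢 p l)))

edgeBetween : ∀ G {u v : Vertex G} → Adj G u v →
  ∃ λ e → e ∈ edges G × (e ≡ (u , v) ⊎ e ≡ (v , u))
edgeBetween G {u} {v} uv with Fin.<-cmp u v
... | tri< u<v _ _  = (u , v) ,
  ∈.∈-filter⁺ _ (∈.∈-cartesianProduct⁺ (∈.∈-allFin u) (∈.∈-allFin v)) (u<v , uv) , inj₁ refl
... | tri≈ _ refl _ = contradiction uv (adj-irrefl G)
... | tri> _ _ v<u  = (v , u) ,
  ∈.∈-filter⁺ _ (∈.∈-cartesianProduct⁺ (∈.∈-allFin v) (∈.∈-allFin u)) (v<u , adj-sym G uv) , inj₂ refl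

-- Vertices of `H` go to distinct edges at `u`. Any two of these share `u`, so every edge of `H` is
-- preserved whatever `H` is.
⊆lineGraph : ∀ B {u : Vertex B} H → Enumeration (order H) (Adj B u) → H ⊆ᴳ lineGraph B
⊆lineGraph B {u} H E = record
  { embed     = embed
  ; injective = embed-injective
  ; preserves = λ {i} {j} ij → fromWitness {a? = lineAdj? B (embed i) (embed j)}
      ((λ eq → adj-irrefl H (subst (Adj H i) (sym (embed-injective eq)) ij)) , u , endpoint i , endpoint j)
  }
  where
  open Enumeration E
  edgeAt = λ i → edgeBetween B (satisfies i)

  embed : Vertex H → Vertex (lineGraph B)
  embed i = index (proj₁ (proj₂ (edgeAt i)))

  lookup-embed : ∀ i → proj₁ (edgeAt i) ≡ lookupᴸ (edges B) (embed i)
  lookup-embed i = Any.lookup-index (proj₁ (proj₂ (edgeAt i)))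

  endpoint : ∀ i → Endpoint u (lookupᴸ (edges B) (embed i))
  endpoint i = subst (Endpoint u) (lookup-embed i) (at (proj₂ (proj₂ (edgeAt i))))
    where
    at : ∀ {e v} → e ≡ (u , v) ⊎ e ≡ (v , u) → Endpoint u e
    at (inj₁ refl) = inj₁ refl
    at (inj₂ refl) = inj₂ refl

  embed-injective : Injective _≡_ _≡_ embed
  embed-injective {i} {j} eq = injective (opposite (proj₂ (proj₂ (edgeAt i))) (proj₂ (proj₂ (edgeAt j)))
    (trans (lookup-embed i) (trans (cong (lookupᴸ (edges B)) eq) (sym (lookup-embed j)))))
    where
    opposite : ∀ {e e′ v w} → e ≡ (u , v) ⊎ e ≡ (v , u) → e′ ≡ (u , w) ⊎ e′ ≡ (w , u) → e ≡ e′ → v ≡ w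
    opposite (inj₁ refl) (inj₁ refl) refl = refl
    opposite (inj₁ refl) (inj₂ refl) refl = refl
    opposite (inj₂ refl) (inj₁ refl) refl = refl
    opposite (inj₂ refl) (inj₂ refl) refl = refl

-- Real numbers

natℚ-^ : ∀ m k → natℚ (m ^ k) ≡ natℚ m ^ℚ k
natℚ-^ m zero    = refl
natℚ-^ m (suc k) = trans (natℚ-* m (m ^ k)) (cong (natℚ m ℚ.*_) (natℚ-^ m k))

*-mono-≤-nonNeg : ∀ {a b c d} → 0ℚ ℚ.≤ b → 0ℚ ℚ.≤ c → a ℚ.≤ b → c ℚ.≤ d → a ℚ.* c ℚ.≤ b ℚ.* d
*-mono-≤-nonNeg {b = b} {c} 0≤b 0≤c a≤b c≤d = ℚ.≤-trans
  (ℚ.*-monoʳ-≤-nonNeg c {{ℚ.nonNegative 0≤c}} a≤b) (ℚ.*-monoˡ-≤-nonNeg b {{ℚ.nonNegative 0≤b}} c≤d)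

^ℚ-nonNeg : ∀ {q} → 0ℚ ℚ.≤ q → ∀ k → 0ℚ ℚ.≤ q ^ℚ k
^ℚ-nonNeg 0≤q zero    = 0≤natℚ 1
^ℚ-nonNeg {q} 0≤q (suc k) = ℚ.≤-trans (ℚ.≤-reflexive (sym (ℚ.*-zeroˡ 0ℚ)))
  (*-mono-≤-nonNeg 0≤q ℚ.≤-refl 0≤q (^ℚ-nonNeg 0≤q k))

^ℚ-mono-≤ : ∀ {p q} → 0ℚ ℚ.≤ p → p ℚ.≤ q → ∀ k → p ^ℚ k ℚ.≤ q ^ℚ k
^ℚ-mono-≤ 0≤p p≤q zero    = ℚ.≤-refl
^ℚ-mono-≤ 0≤p p≤q (suc k) =
  *-mono-≤-nonNeg (ℚ.≤-trans 0≤p p≤q) (^ℚ-nonNeg 0≤p k) p≤q (^ℚ-mono-≤ 0≤p p≤q k)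

unit-fraction≤1 : ∀ m .{{_ : NonZero m}} → (ℤ.+ 1) ℚ./ m ℚ.≤ 1ℚ
unit-fraction≤1 (suc m) = ℚ.toℚᵘ-cancel-≤ (begin
  ℚ.toℚᵘ ((ℤ.+ 1) ℚ./ suc m)  ≃⟨ ℚ.toℚᵘ-fromℚᵘ (ℚᵘ.mkℚᵘ (ℤ.+ 1) m) ⟩
  ℚᵘ.mkℚᵘ (ℤ.+ 1) m           ≤⟨ ℚᵘ.*≤* (ℤ.+≤+ (s≤s z≤n)) ⟩
  ℚ.toℚᵘ 1ℚ                   ∎)
  where open ℚᵘ.≤-Reasoning

floor : ∀ q → 0ℚ ℚ.≤ q → ∃ λ N → natℚ N ℚ.≤ q × q ℚ.< natℚ (suc N)
floor q@(mkℚ (ℤ.+ a) d-1 _) 0≤q = descend (suc a) (ℚ.toℚᵘ-cancel-< (begin-strict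
  ℚᵘ.mkℚᵘ (ℤ.+ a) d-1          <⟨ ℚᵘ.*<* (subst₂ ℤ._<_ (ℤ.pos-* a 1) (ℤ.pos-* (suc a) (suc d-1)) (ℤ.+<+ a<)) ⟩
  ℚᵘ.mkℚᵘ (ℤ.+ suc a) 0        ≃⟨ ℚ.toℚᵘ-fromℚᵘ (ℚᵘ.mkℚᵘ (ℤ.+ suc a) 0) ⟨
  ℚ.toℚᵘ (natℚ (suc a))        ∎))
  where
  open ℚᵘ.≤-Reasoning
  a< : a * 1 < suc a * suc d-1
  a< = ≤-trans (s≤s (≤-reflexive (*-identityʳ a))) (m≤m*n (suc a) (suc d-1))
  descend : ∀ M → q ℚ.< natℚ M → ∃ λ N → natℚ N ℚ.≤ q × q ℚ.< natℚ (suc N)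
  descend zero    q<0 = contradiction (ℚ.<-≤-trans q<0 0≤q) (ℚ.<-irrefl refl)
  descend (suc M) q<  with natℚ M ℚ.≤? q
  ... | yes M≤q = M , M≤q , q<
  ... | no  M≰q = descend M (ℚ.≰⇒> M≰q)
floor q@(mkℚ ℤ.-[1+ _ ] _ _) 0≤q with ℚ.toℚᵘ-mono-≤ 0≤q
... | ℚᵘ.*≤* ()

<⇒cross-<ˡ : ∀ a b {p} → (ℤ.+ a) ℚ./ suc b ℚ.< p → (ℤ.+ a) ℤ.* ℚ.↧ p ℤ.< ℚ.↥ p ℤ.* (ℤ.+ suc b)
<⇒cross-<ˡ a b {p@record{}} lt with ℚᵘ.<-respˡ-≃ (ℚ.toℚᵘ-fromℚᵘ (ℚᵘ.mkℚᵘ (ℤ.+ a) b)) (ℚ.toℚᵘ-mono-< lt)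
... | ℚᵘ.*<* x = x

<⇒cross-<ʳ : ∀ a b {p} → p ℚ.< (ℤ.+ a) ℚ./ suc b → ℚ.↥ p ℤ.* (ℤ.+ suc b) ℤ.< (ℤ.+ a) ℤ.* ℚ.↧ p
<⇒cross-<ʳ a b {p@record{}} lt with ℚᵘ.<-respʳ-≃ (ℚ.toℚᵘ-fromℚᵘ (ℚᵘ.mkℚᵘ (ℤ.+ a) b)) (ℚ.toℚᵘ-mono-< lt)
... | ℚᵘ.*<* x = x

rational : ℚ → ℝ
rational p .cut = fromℚ p
rational p .isDedekind = record
  { lower-inhabited = p ℚ.- 1ℚ , (ℚ.<-respʳ-≡ (ℚ.+-identityʳ p) (ℚ.+-monoʳ-< p (ℚ.neg-antimono-< 0<1)))
  ; upper-inhabited = p ℚ.+ 1ℚ , (ℚ.<-respˡ-≡ (ℚ.+-identityʳ p) (ℚ.+-monoʳ-< p 0<1))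
  ; lower-closed    = ℚ.<-trans
  ; upper-closed    = λ p<q x<p → ℚ.<-trans x<p p<q
  ; lower-open      = λ q<p → let m , q<m , m<p = ℚ.<-dense q<p in m , q<m , m<p
  ; upper-open      = λ p<q → let m , p<m , m<q = ℚ.<-dense p<q in m , m<q , p<m
  ; disjoint        = λ q<p p<q → ℚ.<-asym q<p p<q
  ; located         = locate
  }
  where
  0<1 : 0ℚ ℚ.< 1ℚ
  0<1 = natℚ-mono-< {0} {1} (s≤s z≤n)
  locate : ∀ {x y} → x ℚ.< y → x ℚ.< p ⊎ p ℚ.< y
  locate {x} {y} x<y with ℚ.<-cmp x p
  ... | tri< x<p _ _  = inj₁ x<p
  ... | tri≈ _ refl _ = inj₂ x<y
  ... | tri> _ _ p<x  = inj₂ (ℚ.<-trans p<x x<y)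

lower<upper : ∀ (x : ℝ) {p q} → lower (cut x) p → upper (cut x) q → p ℚ.< q
lower<upper x {p} {q} p<x x<q with ℚ.<-cmp p q
... | tri< p<q _ _  = p<q
... | tri≈ _ refl _ = contradiction x<q (IsDedekind.disjoint (isDedekind x) p<x)
... | tri> _ _ q<p  = contradiction x<q
  (IsDedekind.disjoint (isDedekind x) (IsDedekind.lower-closed (isDedekind x) q<p p<x))

-- The summand 2 q ^ k makes the induction work: it dominates the remaining geometric tail, since q
-- ^ k / k! ≤ q ^ k and 2 q ^ (k + 1) ≤ q ^ k.
expSum-bounded : ∀ {q} → 0ℚ ℚ.≤ q → natℚ 2 ℚ.* q ℚ.≤ 1ℚ →
  ∀ k → expSum k q ℚ.+ natℚ 2 ℚ.* q ^ℚ k ℚ.≤ natℚ 2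
expSum-bounded 0≤q 2q≤1 zero    = ℚ.≤-refl
expSum-bounded {q} 0≤q 2q≤1 (suc k) = begin
  expSum k q ℚ.+ x ℚ.* i ℚ.+ natℚ 2 ℚ.* (q ℚ.* x)
    ≡⟨ ℚ.+-assoc (expSum k q) (x ℚ.* i) (natℚ 2 ℚ.* (q ℚ.* x)) ⟩
  expSum k q ℚ.+ (x ℚ.* i ℚ.+ natℚ 2 ℚ.* (q ℚ.* x))
    ≡⟨ cong (λ y → expSum k q ℚ.+ (x ℚ.* i ℚ.+ y)) (ℚ.*-assoc (natℚ 2) q x) ⟨
  expSum k q ℚ.+ (x ℚ.* i ℚ.+ natℚ 2 ℚ.* q ℚ.* x)
    ≤⟨ ℚ.+-monoʳ-≤ (expSum k q) (ℚ.+-mono-≤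
         (ℚ.*-monoˡ-≤-nonNeg x {{0≤x}} (unit-fraction≤1 (k !) {{k !≢0}}))
         (ℚ.*-monoʳ-≤-nonNeg x {{0≤x}} 2q≤1)) ⟩
  expSum k q ℚ.+ (x ℚ.* 1ℚ ℚ.+ 1ℚ ℚ.* x)
    ≡⟨ cong (λ y → expSum k q ℚ.+ (y ℚ.+ 1ℚ ℚ.* x)) (ℚ.*-comm x 1ℚ) ⟩
  expSum k q ℚ.+ (1ℚ ℚ.* x ℚ.+ 1ℚ ℚ.* x)
    ≡⟨ cong (expSum k q ℚ.+_) (ℚ.*-distribʳ-+ x 1ℚ 1ℚ) ⟨
  expSum k q ℚ.+ natℚ 2 ℚ.* x
    ≤⟨ expSum-bounded 0≤q 2q≤1 k ⟩
  natℚ 2 ∎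
  where
  open ℚ.≤-Reasoning
  x = q ^ℚ k
  i = ℚ._/_ (ℤ.+ 1) (k !) {{k !≢0}}
  0≤x : ℚ.NonNegative x
  0≤x = ℚ.nonNegative (^ℚ-nonNeg 0≤q k)

-- log n ≥ 1/2 for n ≥ 2, because exp (1/2) ≤ 1 + 1/2 + 1/4 + … = 2.
log-upper : ∀ {n b} → 2 ≤ n → upper (log n) b → 1ℚ ℚ.≤ natℚ 2 ℚ.* b
log-upper {n} {b} 2≤n (0≤b , k , n<exp) with 1ℚ ℚ.≤? natℚ 2 ℚ.* b
... | yes 1≤2b = 1≤2b
... | no  1≰2b = contradiction (natℚ-cancel-< {n} {2} (begin-strict
  natℚ n                              <⟨ n<exp ⟩
  expSum k b                          ≡⟨ ℚ.+-identityʳ (expSum k b) ⟨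
  expSum k b ℚ.+ 0ℚ                   ≤⟨ ℚ.+-monoʳ-≤ (expSum k b)
                                           (ℚ.≤-trans (ℚ.≤-reflexive (sym (ℚ.*-zeroʳ (natℚ 2))))
                                           (ℚ.*-monoˡ-≤-nonNeg (natℚ 2) {{_}} (^ℚ-nonNeg 0≤b k))) ⟩
  expSum k b ℚ.+ natℚ 2 ℚ.* b ^ℚ k    ≤⟨ expSum-bounded 0≤b (ℚ.<⇒≤ (ℚ.≰⇒> 1≰2b)) k ⟩
  natℚ 2                              ∎)) (≤⇒≯ 2≤n)
  where open ℚ.≤-Reasoning

root-≤ : ∀ n .{{_ : NonZero n}} N a b A B → N ^ suc b ≤ n ^ a → a * B ≤ A * suc b → N ^ B ≤ n ^ A
root-≤ n N a b A B N≤n aB≤Ab = ^-cancelˡ-≤ (suc b) (begin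
  (N ^ B) ^ suc b     ≡⟨ ^-swap N B (suc b) ⟩
  (N ^ suc b) ^ B     ≤⟨ ^-monoˡ-≤ B N≤n ⟩
  (n ^ a) ^ B         ≡⟨ ^-*-assoc n a B ⟩
  n ^ (a * B)         ≤⟨ ^-monoʳ-≤ n aB≤Ab ⟩
  n ^ (A * suc b)     ≡⟨ ^-*-assoc n A (suc b) ⟨
  (n ^ A) ^ suc b     ∎)
  where open ≤-Reasoning

-- The exponent a / (b + 1) witnessing y < n ^ θ varies with `y` and `n`. Passing to the fixed `p`
-- above θ gives one pair A, B, hence one threshold for `largeGirthGraph`; rounding `y` down to `N`
-- gives integer powers.
^ᶜ-lower : ∀ (θ : ℝ) n .{{_ : NonZero n}} p {A} → ℚ.↥ p ≡ ℤ.+ A → upper (cut θ) p →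
  ∀ {y} → 0ℚ ℚ.≤ y → lower (n ^ᶜ cut θ) y → ∃ λ N → y ℚ.< natℚ (suc N) × N ^ ℚ.↧ₙ p ≤ n ^ A
^ᶜ-lower θ n p {A} ↥p≡A θ<p {y} 0≤y (inj₁ y<0) = contradiction (ℚ.<-≤-trans y<0 0≤y) (ℚ.<-irrefl refl)
^ᶜ-lower θ n p {A} ↥p≡A θ<p {y} 0≤y (inj₂ (a , b , a/b<θ , y^b<n^a)) with floor y 0≤y
... | N , N≤y , y<1+N = N , y<1+N , root-≤ n N a b A (ℚ.↧ₙ p) (<⇒≤ N^b<n^a) (<⇒≤ aB<Ab)
  where
  open ℚ.≤-Reasoning
  N^b<n^a : N ^ suc b < n ^ a
  N^b<n^a = natℚ-cancel-< {N ^ suc b} {n ^ a} (begin-strict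
    natℚ (N ^ suc b)    ≡⟨ natℚ-^ N (suc b) ⟩
    natℚ N ^ℚ suc b     ≤⟨ ^ℚ-mono-≤ (0≤natℚ N) N≤y (suc b) ⟩
    y ^ℚ suc b          <⟨ y^b<n^a ⟩
    natℚ n ^ℚ a         ≡⟨ natℚ-^ n a ⟨
    natℚ (n ^ a)        ∎)
  aB<Ab : a * ℚ.↧ₙ p < A * suc b
  aB<Ab = ℤ.drop‿+<+ (subst₂ ℤ._<_ (sym (ℤ.pos-* a (ℚ.↧ₙ p)))
    (trans (cong (ℤ._* ℤ.+ suc b) ↥p≡A) (sym (ℤ.pos-* A (suc b))))
    (<⇒cross-<ˡ a b (lower<upper θ a/b<θ θ<p)))

-- For positive `N` because 2 (N + 1) ≤ 4 N; for N = 0 the right side is at least 4 ^ B. This is the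
-- source of the constant D = 4 ^ B.
2[1+N]^B≤ : ∀ N n A B .{{_ : NonZero n}} → N ^ B ≤ n ^ A → (2 * suc N) ^ B ≤ 4 ^ B * n ^ A
2[1+N]^B≤ zero    n A B _   = ≤-trans (^-monoˡ-≤ B (s≤s (s≤s z≤n))) (m≤m*n (4 ^ B) (n ^ A) {{m^n≢0 n A}})
2[1+N]^B≤ (suc N) n A B le = begin
  (2 * (1 + suc N)) ^ B       ≤⟨ ^-monoˡ-≤ B (*-monoʳ-≤ 2 (+-monoˡ-≤ (suc N) (s≤s z≤n))) ⟩
  (2 * (suc N + suc N)) ^ B   ≡⟨ cong (λ m → (2 * m) ^ B) (cong (suc N +_) (+-identityʳ (suc N))) ⟨
  (2 * (2 * suc N)) ^ B       ≡⟨ cong (_^ B) (*-assoc 2 2 (suc N)) ⟨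
  (4 * suc N) ^ B             ≡⟨ ^-distribʳ-* 4 (suc N) B ⟩
  4 ^ B * suc N ^ B           ≤⟨ *-monoʳ-≤ (4 ^ B) le ⟩
  4 ^ B * n ^ A               ∎
  where open ≤-Reasoning

-- Transfer to line graphs of generalized polygons

hᶠ-lower : ∀ {K} 𝒢 {s r q} t → IsGeneralized K 𝒢 → HasOrder 𝒢 s → GraphWith (suc s) r t →
  q ℚ.< natℚ t → lower (hᶠ r (lineGraph (incidenceGraph 𝒢))) q
-- A vertex `u` attaining the diameter shows that the incidence graph is nonempty and serves as the
-- centre of the clique.
hᶠ-lower 𝒢 t ((_ , u , _) , _) hasOrder (H , |H|≡1+s , girth , t≤total) q<t =
  (H , ⊆lineGraph (incidenceGraph 𝒢) {u} H
         (subst (λ k → Enumeration k (Adj (incidenceGraph 𝒢) u)) (sym |H|≡1+s)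
           (neighbours 𝒢 hasOrder u)) , girth) ,
  natℚ t , q<t , t≤total

corollary10p7 : ∀ (r : ℕ) → 4 ≤ r →
    (∀ (K : Kind) → r ≤ girthOf K → (seq : PolygonSequence K) →
    let open PolygonSequence seq in
    (λ i → hᶠ r (lineGraph (B i))) →∞)
    ×
    (∀ (θ : ℝ) → fromℚ 0ℚ <ᶜ cut θ → cut θ <ᶜ fromℚ (recip (r ∸ 1)) →
    Σ ℝ λ c → fromℚ 0ℚ <ᶜ cut c ×
    (∀ (K : Kind) → r ≤ girthOf K → (seq : PolygonSequence K) →
    let open PolygonSequence seq in
    ∃ λ s₀ → ∀ i → s₀ ≤ s i →
    cut c ⊗ (Δ i ^ᶜ cut θ) ⊘ log (Δ i) ≤ᶜ hᶠ r (lineGraph (B i))))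
corollary10p7 (suc zero) (s≤s ())
corollary10p7 (suc g@(suc g-1)) _ = unbounded , quantitative
  where
  unbounded : ∀ K → suc g ≤ girthOf K → (seq : PolygonSequence K) → let open PolygonSequence seq in
    (λ i → hᶠ (suc g) (lineGraph (B i))) →∞
  unbounded K _ seq M = N , λ i N≤i q q<M → hᶠ-lower (geometry i) (suc M) (generalized i) (hasOrder i)
      (graphs (Δ i) (≤-trans (n₀≤s i N≤i) (n≤1+n (s i))) (suc M) ≤-refl)
      (ℚ.<-trans q<M (natℚ-mono-< (n<1+n M)))
    where
    open PolygonSequence seq
    -- The exponent 0 / 1 makes D = M + 1 a constant target; the successor keeps it nonzero when M =
    -- 0.
    graphs = proj₂ (largeGirthGraph g 0 1 (suc M) (s≤s z≤n))
    N = proj₁ (s→∞ (proj₁ (largeGirthGraph g 0 1 (suc M) (s≤s z≤n))))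
    n₀≤s = proj₂ (s→∞ (proj₁ (largeGirthGraph g 0 1 (suc M) (s≤s z≤n))))

  quantitative : ∀ (θ : ℝ) → fromℚ 0ℚ <ᶜ cut θ → cut θ <ᶜ fromℚ (recip g) →
    Σ ℝ λ c → fromℚ 0ℚ <ᶜ cut c ×
    (∀ K → suc g ≤ girthOf K → (seq : PolygonSequence K) → let open PolygonSequence seq in
     ∃ λ s₀ → ∀ i → s₀ ≤ s i →
     cut c ⊗ (Δ i ^ᶜ cut θ) ⊘ log (Δ i) ≤ᶜ hᶠ (suc g) (lineGraph (B i)))
  quantitative θ (q₀ , 0<q₀ , q₀<θ) (p@(mkℚ ℤ.-[1+ _ ] _ _) , θ<p , _) =
    contradiction (ℚ.<-trans 0<q₀ (lower<upper θ q₀<θ θ<p)) λ { (ℚ.*<* ()) }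
  -- The constant 1 suffices: all losses go into D = 4 ^ B, and the passage from θ to `p` < 1 / g
  -- lets the threshold on `s` absorb it.
  quantitative θ _ (p@(mkℚ (ℤ.+ A) B-1 _) , θ<p , p<1/g) = rational 1ℚ , 0<1 , bound
    where
    B′ = suc B-1

    0<1 : fromℚ 0ℚ <ᶜ fromℚ 1ℚ
    0<1 = let m , 0<m , m<1 = ℚ.<-dense (natℚ-mono-< {0} {1} (s≤s z≤n)) in m , 0<m , m<1

    Ag<B : A * g < B′
    Ag<B = ℤ.drop‿+<+ (subst₂ ℤ._<_ (sym (ℤ.pos-* A g)) (ℤ.*-identityˡ (ℤ.+ B′)) (<⇒cross-<ʳ 1 g-1 p<1/g))

    n₀ : ℕ
    n₀ = proj₁ (largeGirthGraph g A B′ (4 ^ B′) Ag<B)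

    bound : ∀ K → suc g ≤ girthOf K → (seq : PolygonSequence K) → let open PolygonSequence seq in
      ∃ λ s₀ → ∀ i → s₀ ≤ s i →
      fromℚ 1ℚ ⊗ (Δ i ^ᶜ cut θ) ⊘ log (Δ i) ≤ᶜ hᶠ (suc g) (lineGraph (B i))
    -- The successor ensures s ≥ 1, so that Δ ≥ 2 and log Δ ≥ 1/2.
    bound K _ seq = suc n₀ , λ { i s₀≤s q (a , b , (x , y , x<1 , y<Δ^θ , 0≤x , 0≤y , a<xy) , logΔ<b , qb<a) →
      let n₀≤s , 1≤s = ≤-trans (n≤1+n n₀) s₀≤s , ≤-trans (s≤s z≤n) s₀≤s
          N , y<1+N , N^B≤ = ^ᶜ-lower θ (Δ i) p refl θ<p 0≤y y<Δ^θ
          -- N + 1 exceeds `y`, and the factor 2 compensates for the bound 1/2 on the logarithm: q b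
          -- < y < N + 1 ≤ 2 (N + 1) b.
          t = 2 * suc N
          qb<t*b : q ℚ.* b ℚ.< natℚ t ℚ.* b
          qb<t*b = chain q a b x y N x<1 0≤y a<xy y<1+N (log-upper (s≤s 1≤s) logΔ<b) qb<a
      in hᶠ-lower (geometry i) t (generalized i) (hasOrder i)
           (proj₂ (largeGirthGraph g A B′ (4 ^ B′) Ag<B) (Δ i) (≤-trans n₀≤s (n≤1+n (s i))) t
             (2[1+N]^B≤ N (Δ i) A B′ N^B≤))
           (ℚ.*-cancelʳ-<-nonNeg b {{ℚ.nonNegative (proj₁ logΔ<b)}} qb<t*b) }
      where
      open PolygonSequence seq
      chain : ∀ q a b x y N → x ℚ.< 1ℚ → 0ℚ ℚ.≤ y → a ℚ.< x ℚ.* y → y ℚ.< natℚ (suc N) →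
        1ℚ ℚ.≤ natℚ 2 ℚ.* b → q ℚ.* b ℚ.< a → q ℚ.* b ℚ.< natℚ (2 * suc N) ℚ.* b
      chain q a b x y N x<1 0≤y a<xy y<1+N 1≤2b qb<a = begin-strict
        q ℚ.* b                                  <⟨ qb<a ⟩
        a                                        <⟨ a<xy ⟩
        x ℚ.* y                                  ≤⟨ ℚ.*-monoʳ-≤-nonNeg y {{ℚ.nonNegative 0≤y}} (ℚ.<⇒≤ x<1) ⟩
        1ℚ ℚ.* y                                 ≡⟨ ℚ.*-identityˡ y ⟩
        y                                        <⟨ y<1+N ⟩
        natℚ (suc N)                             ≡⟨ ℚ.*-identityʳ (natℚ (suc N)) ⟨
        natℚ (suc N) ℚ.* 1ℚ                      ≤⟨ ℚ.*-monoˡ-≤-nonNeg (natℚ (suc N))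
                                                      {{ℚ.nonNegative (0≤natℚ (suc N))}} 1≤2b ⟩
        natℚ (suc N) ℚ.* (natℚ 2 ℚ.* b)          ≡⟨ ℚ.*-assoc (natℚ (suc N)) (natℚ 2) b ⟨
        natℚ (suc N) ℚ.* natℚ 2 ℚ.* b            ≡⟨ cong (ℚ._* b) (ℚ.*-comm (natℚ (suc N)) (natℚ 2)) ⟩
        natℚ 2 ℚ.* natℚ (suc N) ℚ.* b            ≡⟨ cong (ℚ._* b) (natℚ-* 2 (suc N)) ⟨
        natℚ (2 * suc N) ℚ.* b                   ∎
        where open ℚ.≤-Reasoning
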